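{- Let $k,q$ be positive integers, let $N=2q+1$, and let $a,b>0$. Then $$ \begin{aligned} &\sum_{n=0}^{\infty}\frac{(-1)^n}{(n+b)^{4k(q+1)}}\sum_{i=0}^{\infty}\frac{(-1)^i(n+b)^{2k}}{(n+b)^{2k}+(i+a)^{2k}} +\sum_{n=0}^{\infty}\frac{(-1)^n}{(n+a)^{4k(q+1)}}\sum_{i=0}^{\infty}\frac{(-1)^i(n+a)^{2k}}{(n+a)^{2k}+(i+b)^{2k}}\\ &=\sum_{p=1}^{2q+1}(-1)^{p+1}\zeta_E(2kp,a)\,\zeta_E(2k(N-p+1),b). \end{aligned} $$
   Context: The alternating Hurwitz zeta function is $\zeta_E(z,x)=\sum_{n=0}^{\infty}\frac{(-1)^n}{(n+x)^z}$ for $\operatorname{Re}(z)>0$ and $x\neq0,-1,-2,\dots$. -}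

module Defs where

open import Algebra.Bundles.Raw using (RawRing)
import Algebra.Definitions.RawSemiring as RawSemiringDefinitions
open import Data.Empty using (⊥-elim)
open import Data.Fin.Base using (toℕ)
import Data.Integer.Base as ℤ
open import Data.Nat.Base as ℕ using (ℕ; zero; suc)
import Data.Nat.Properties as ℕ
open import Data.Product.Base using (∃; _×_; _,_; proj₁; proj₂)
open import Data.Rational.Base as ℚ using (ℚ; 0ℚ; 1ℚ; ½)
import Data.Rational.Properties as ℚ
open import Data.Rational.Solver using (module +-*-Solver)
open import Data.Sum.Base using (inj₁; inj₂)
open import Level using (0ℓ)
open import Relation.Binary.PropositionalEquality
  using (_≡_; refl; sym; trans; cong; cong₂; subst; subst₂)
open import Relation.Nullary using (yes; no)

open +-*-Solver using (solve; _:+_; _:*_; _:-_; :-_; _:=_)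

0<* : ∀ {p q} → 0ℚ ℚ.< p → 0ℚ ℚ.< q → 0ℚ ℚ.< p ℚ.* q
0<* {p} {q} p>0 q>0 =
  ℚ.positive⁻¹ (p ℚ.* q) {{ℚ.pos*pos⇒pos p {{ℚ.positive p>0}} q {{ℚ.positive q>0}}}}

0<+ : ∀ {p q} → 0ℚ ℚ.< p → 0ℚ ℚ.≤ q → 0ℚ ℚ.< p ℚ.+ q
0<+ {p} {q} p>0 q≥0 = subst (ℚ._< p ℚ.+ q) (ℚ.+-identityˡ 0ℚ) (ℚ.+-mono-<-≤ p>0 q≥0)

*-mono-≤ : ∀ {p q r s} → 0ℚ ℚ.≤ p → 0ℚ ℚ.≤ s → p ℚ.≤ q → r ℚ.≤ s → p ℚ.* r ℚ.≤ q ℚ.* s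
*-mono-≤ {p} {q} {r} {s} p≥0 s≥0 p≤q r≤s = ℚ.≤-trans
  (ℚ.*-monoˡ-≤-nonNeg p {{ℚ.nonNegative p≥0}} r≤s)
  (ℚ.*-monoʳ-≤-nonNeg s {{ℚ.nonNegative s≥0}} p≤q)

½+½ : ∀ ε → ½ ℚ.* ε ℚ.+ ½ ℚ.* ε ≡ ε
½+½ ε = trans (sym (ℚ.*-distribʳ-+ ε ½ ½)) (ℚ.*-identityˡ ε)

½>0 : ∀ {ε} → 0ℚ ℚ.< ε → 0ℚ ℚ.< ½ ℚ.* ε
½>0 = 0<* (ℚ.positive⁻¹ ½)

∣p∣≤∣p-q∣+∣q∣ : ∀ p q → ℚ.∣ p ∣ ℚ.≤ ℚ.∣ p ℚ.- q ∣ ℚ.+ ℚ.∣ q ∣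
∣p∣≤∣p-q∣+∣q∣ p q = subst (λ r → ℚ.∣ r ∣ ℚ.≤ ℚ.∣ p ℚ.- q ∣ ℚ.+ ℚ.∣ q ∣)
  (solve 2 (λ p q → (p :- q) :+ q := p) refl p q)
  (ℚ.∣p+q∣≤∣p∣+∣q∣ (p ℚ.- q) q)

∣p-q∣≡∣q-p∣ : ∀ p q → ℚ.∣ p ℚ.- q ∣ ≡ ℚ.∣ q ℚ.- p ∣
∣p-q∣≡∣q-p∣ p q = trans (sym (ℚ.∣-p∣≡∣p∣ (p ℚ.- q)))
  (cong ℚ.∣_∣ (solve 2 (λ p q → :- (p :- q) := q :- p) refl p q))

∣p∣-∣q∣≤∣p-q∣ : ∀ p q → ℚ.∣ p ∣ ℚ.- ℚ.∣ q ∣ ℚ.≤ ℚ.∣ p ℚ.- q ∣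
∣p∣-∣q∣≤∣p-q∣ p q = subst (ℚ.∣ p ∣ ℚ.- ℚ.∣ q ∣ ℚ.≤_)
  (solve 2 (λ d q → (d :+ q) :- q := d) refl ℚ.∣ p ℚ.- q ∣ ℚ.∣ q ∣)
  (ℚ.+-monoˡ-≤ (ℚ.- ℚ.∣ q ∣) (∣p∣≤∣p-q∣+∣q∣ p q))

∣∣p∣-∣q∣∣≤∣p-q∣ : ∀ p q → ℚ.∣ ℚ.∣ p ∣ ℚ.- ℚ.∣ q ∣ ∣ ℚ.≤ ℚ.∣ p ℚ.- q ∣
∣∣p∣-∣q∣∣≤∣p-q∣ p q with ℚ.∣p∣≡p∨∣p∣≡-p (ℚ.∣ p ∣ ℚ.- ℚ.∣ q ∣)
... | inj₁ e = ℚ.≤-trans (ℚ.≤-reflexive e) (∣p∣-∣q∣≤∣p-q∣ p q)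
... | inj₂ e = subst₂ ℚ._≤_
  (sym (trans e (solve 2 (λ p q → :- (p :- q) := q :- p) refl ℚ.∣ p ∣ ℚ.∣ q ∣)))
  (∣p-q∣≡∣q-p∣ q p) (∣p∣-∣q∣≤∣p-q∣ q p)

-- The inverse on ℚ made total by the value 0 at 0, so that it can be applied
-- to every entry of a sequence of which only the tail is known to be nonzero.
recipℚ : ℚ → ℚ
recipℚ p with p ℚ.≟ 0ℚ
... | yes _  = 0ℚ
... | no p≢0 = ℚ.1/_ p {{ℚ.≢-nonZero p≢0}}

recipℚ-inverse : ∀ {p} → 0ℚ ℚ.< p → recipℚ p ℚ.* p ≡ 1ℚ
recipℚ-inverse {p} p>0 with p ℚ.≟ 0ℚ
... | yes p≡0 = ⊥-elim (ℚ.<-irrefl (sym p≡0) p>0)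
... | no p≢0  = ℚ.*-inverseˡ p {{ℚ.≢-nonZero p≢0}}

recipℚ>0 : ∀ {p} → 0ℚ ℚ.< p → 0ℚ ℚ.< recipℚ p
recipℚ>0 {p} p>0 = ℚ.*-cancelʳ-<-nonNeg p {{ℚ.nonNegative (ℚ.<⇒≤ p>0)}}
  (subst₂ ℚ._<_ (sym (ℚ.*-zeroˡ p)) (sym (recipℚ-inverse p>0)) (ℚ.positive⁻¹ 1ℚ))

recipℚ-lower : ∀ {δ p} → 0ℚ ℚ.< δ → δ ℚ.≤ p → recipℚ p ℚ.* δ ℚ.≤ 1ℚ
recipℚ-lower {δ} {p} δ>0 δ≤p = subst (recipℚ p ℚ.* δ ℚ.≤_) (recipℚ-inverse p>0)
  (ℚ.*-monoˡ-≤-nonNeg (recipℚ p) {{ℚ.nonNegative (ℚ.<⇒≤ (recipℚ>0 p>0))}} δ≤p)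
  where p>0 = ℚ.<-≤-trans δ>0 δ≤p

IsCauchy : (ℕ → ℚ) → Set
IsCauchy s = ∀ ε → 0ℚ ℚ.< ε →
  ∃ λ M → ∀ m n → M ℕ.≤ m → M ℕ.≤ n → ℚ.∣ s m ℚ.- s n ∣ ℚ.< ε

-- The real numbers are the Cauchy sequences of rationals, with _≈_ as equality.
record ℝ : Set where
  no-eta-equality
  field
    seq    : ℕ → ℚ
    cauchy : IsCauchy seq

open ℝ public

infix 4 _≈_ _<_

record _≈_ (x y : ℝ) : Set where
  constructor mk≈
  field
    close : ∀ ε → 0ℚ ℚ.< ε →
      ∃ λ M → ∀ n → M ℕ.≤ n → ℚ.∣ seq x n ℚ.- seq y n ∣ ℚ.< ε

-- From some index on, y exceeds x by a fixed positive rational.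
record _<_ (x y : ℝ) : Set where
  constructor mk<
  field
    gap   : ℚ
    gap>0 : 0ℚ ℚ.< gap
    from  : ℕ
    gap≤  : ∀ n → from ℕ.≤ n → gap ℚ.≤ seq y n ℚ.- seq x n

open _≈_ public
open _<_ public

private
  lub₁ : ∀ {m n o} → m ℕ.⊔ n ℕ.≤ o → m ℕ.≤ o
  lub₁ {m} {n} = ℕ.m⊔n≤o⇒m≤o m n

  lub₂ : ∀ {m n o} → m ℕ.⊔ n ℕ.≤ o → n ℕ.≤ o
  lub₂ {m} {n} = ℕ.m⊔n≤o⇒n≤o m n

+-cauchy : ∀ {s t} → IsCauchy s → IsCauchy t → IsCauchy (λ n → s n ℚ.+ t n)
+-cauchy {s} {t} cs ct ε ε>0 with cs (½ ℚ.* ε) (½>0 ε>0) | ct (½ ℚ.* ε) (½>0 ε>0)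
... | M , p | M′ , q = M ℕ.⊔ M′ , λ m n hm hn → ℚ.≤-<-trans
  (subst (λ r → ℚ.∣ r ∣ ℚ.≤ ℚ.∣ s m ℚ.- s n ∣ ℚ.+ ℚ.∣ t m ℚ.- t n ∣)
    (solve 4 (λ a b c d → (a :- b) :+ (c :- d) := (a :+ c) :- (b :+ d)) refl
      (s m) (s n) (t m) (t n))
    (ℚ.∣p+q∣≤∣p∣+∣q∣ (s m ℚ.- s n) (t m ℚ.- t n)))
  (subst (ℚ.∣ s m ℚ.- s n ∣ ℚ.+ ℚ.∣ t m ℚ.- t n ∣ ℚ.<_) (½+½ ε)
    (ℚ.+-mono-< (p m n (lub₁ hm) (lub₁ hn)) (q m n (lub₂ {M} hm) (lub₂ {M} hn))))

neg-cauchy : ∀ {s} → IsCauchy s → IsCauchy (λ n → ℚ.- s n)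
neg-cauchy {s} cs ε ε>0 with cs ε ε>0
... | M , p = M , λ m n hm hn → subst (ℚ._< ε)
  (trans (∣p-q∣≡∣q-p∣ (s m) (s n))
    (cong ℚ.∣_∣ (solve 2 (λ a b → b :- a := (:- a) :- (:- b)) refl (s m) (s n))))
  (p m n hm hn)

abs-cauchy : ∀ {s} → IsCauchy s → IsCauchy (λ n → ℚ.∣ s n ∣)
abs-cauchy {s} cs ε ε>0 with cs ε ε>0
... | M , p = M , λ m n hm hn → ℚ.≤-<-trans (∣∣p∣-∣q∣∣≤∣p-q∣ (s m) (s n)) (p m n hm hn)

cauchy⇒bounded : ∀ {s} → IsCauchy s →
  ∃ λ B → (0ℚ ℚ.< B) × ∃ λ M → ∀ n → M ℕ.≤ n → ℚ.∣ s n ∣ ℚ.≤ B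
cauchy⇒bounded {s} cs with cs 1ℚ (ℚ.positive⁻¹ 1ℚ)
... | M , p = 1ℚ ℚ.+ ℚ.∣ s M ∣ , 0<+ (ℚ.positive⁻¹ 1ℚ) (ℚ.0≤∣p∣ (s M)) , M ,
  λ n hn → ℚ.≤-trans (∣p∣≤∣p-q∣+∣q∣ (s n) (s M))
    (ℚ.+-monoˡ-≤ ℚ.∣ s M ∣ (ℚ.<⇒≤ (p n M hn ℕ.≤-refl)))

∣u*v∣< : ∀ {D h} u v → 0ℚ ℚ.< D → ℚ.∣ u ∣ ℚ.≤ D → ℚ.∣ v ∣ ℚ.< recipℚ D ℚ.* h → ℚ.∣ u ℚ.* v ∣ ℚ.< h
∣u*v∣< {D} {h} u v D>0 u≤D v< = ℚ.≤-<-trans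
  (ℚ.≤-trans (ℚ.≤-reflexive (ℚ.∣p*q∣≡∣p∣*∣q∣ u v))
    (ℚ.*-monoʳ-≤-nonNeg ℚ.∣ v ∣ {{ℚ.∣-∣-nonNeg v}} u≤D))
  (subst (D ℚ.* ℚ.∣ v ∣ ℚ.<_) D*[r*h]≡h (ℚ.*-monoʳ-<-pos D {{ℚ.positive D>0}} v<))
  where
  D*[r*h]≡h : D ℚ.* (recipℚ D ℚ.* h) ≡ h
  D*[r*h]≡h = trans (sym (ℚ.*-assoc D (recipℚ D) h))
    (trans (cong (ℚ._* h) (trans (ℚ.*-comm D (recipℚ D)) (recipℚ-inverse D>0))) (ℚ.*-identityˡ h))

∣ac-bd∣< : ∀ a b c d {g h} → ℚ.∣ a ℚ.* (c ℚ.- d) ∣ ℚ.< g → ℚ.∣ d ℚ.* (a ℚ.- b) ∣ ℚ.< h →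
  ℚ.∣ a ℚ.* c ℚ.- b ℚ.* d ∣ ℚ.< g ℚ.+ h
∣ac-bd∣< a b c d p q = ℚ.≤-<-trans
  (subst (λ r → ℚ.∣ r ∣ ℚ.≤ ℚ.∣ u ∣ ℚ.+ ℚ.∣ v ∣)
    (solve 4 (λ a b c d → a :* (c :- d) :+ d :* (a :- b) := a :* c :- b :* d) refl a b c d)
    (ℚ.∣p+q∣≤∣p∣+∣q∣ u v))
  (ℚ.+-mono-< p q)
  where
  u = a ℚ.* (c ℚ.- d)
  v = d ℚ.* (a ℚ.- b)

*-cauchy : ∀ {s t} → IsCauchy s → IsCauchy t → IsCauchy (λ n → s n ℚ.* t n)
*-cauchy {s} {t} cs ct ε ε>0 = K ℕ.⊔ K′ ℕ.⊔ (M ℕ.⊔ M′) , λ m n hm hn →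
  subst (ℚ.∣ s m ℚ.* t m ℚ.- s n ℚ.* t n ∣ ℚ.<_) (½+½ ε) (∣ac-bd∣< (s m) (s n) (t m) (t n)
    (∣u*v∣< (s m) (t m ℚ.- t n) B>0 (b m (lub₁ (lub₁ hm)))
      (q m n (lub₂ {M} (lub₂ {K ℕ.⊔ K′} hm)) (lub₂ {M} (lub₂ {K ℕ.⊔ K′} hn))))
    (∣u*v∣< (t n) (s m ℚ.- s n) C>0 (c n (lub₂ {K} (lub₁ hn)))
      (p m n (lub₁ (lub₂ {K ℕ.⊔ K′} hm)) (lub₁ (lub₂ {K ℕ.⊔ K′} hn)))))
  where
  bs = cauchy⇒bounded cs
  bt = cauchy⇒bounded ct
  B = proj₁ bs
  B>0 = proj₁ (proj₂ bs)
  K = proj₁ (proj₂ (proj₂ bs))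
  b = proj₂ (proj₂ (proj₂ bs))
  C = proj₁ bt
  C>0 = proj₁ (proj₂ bt)
  K′ = proj₁ (proj₂ (proj₂ bt))
  c = proj₂ (proj₂ (proj₂ bt))
  cs′ = cs (recipℚ C ℚ.* (½ ℚ.* ε)) (0<* (recipℚ>0 C>0) (½>0 ε>0))
  ct′ = ct (recipℚ B ℚ.* (½ ℚ.* ε)) (0<* (recipℚ>0 B>0) (½>0 ε>0))
  M = proj₁ cs′
  p = proj₂ cs′
  M′ = proj₁ ct′
  q = proj₂ ct′

recip-cauchy : ∀ {s} → IsCauchy s → ∀ δ → 0ℚ ℚ.< δ → ∀ K → (∀ n → K ℕ.≤ n → δ ℚ.≤ s n) →
  IsCauchy (λ n → recipℚ (s n))
recip-cauchy {s} cs δ δ>0 K low ε ε>0 with cs (ε ℚ.* (δ ℚ.* δ)) (0<* ε>0 (0<* δ>0 δ>0))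
... | M , p = K ℕ.⊔ M , bound
  where
  bound : ∀ m n → K ℕ.⊔ M ℕ.≤ m → K ℕ.⊔ M ℕ.≤ n → ℚ.∣ recipℚ (s m) ℚ.- recipℚ (s n) ∣ ℚ.< ε
  bound m n hm hn = ℚ.≤-<-trans (ℚ.≤-reflexive ∣i-j∣≡) (ℚ.<-≤-trans
    (ℚ.*-monoʳ-<-pos (i ℚ.* j) {{ℚ.positive ij>0}} (p m n (lub₂ {K} hm) (lub₂ {K} hn)))
    (subst₂ ℚ._≤_
      (solve 4 (λ e d i j → e :* ((i :* d) :* (j :* d)) := (i :* j) :* (e :* (d :* d))) refl ε δ i j)
      (trans (cong (ε ℚ.*_) (ℚ.*-identityˡ 1ℚ)) (ℚ.*-identityʳ ε))
      (ℚ.*-monoˡ-≤-nonNeg ε {{ℚ.nonNegative (ℚ.<⇒≤ ε>0)}}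
        (*-mono-≤ (ℚ.<⇒≤ (0<* i>0 δ>0)) (ℚ.<⇒≤ (ℚ.positive⁻¹ 1ℚ))
          (recipℚ-lower δ>0 xδ) (recipℚ-lower δ>0 yδ)))))
    where
    x = s m
    y = s n
    i = recipℚ x
    j = recipℚ y
    xδ = low m (lub₁ hm)
    yδ = low n (lub₁ hn)
    x>0 = ℚ.<-≤-trans δ>0 xδ
    y>0 = ℚ.<-≤-trans δ>0 yδ
    i>0 = recipℚ>0 x>0
    ij>0 = 0<* i>0 (recipℚ>0 y>0)
    i-j≡ : i ℚ.- j ≡ (i ℚ.* j) ℚ.* (y ℚ.- x)
    i-j≡ = sym (trans
      (solve 4 (λ i j x y → (i :* j) :* (y :- x) := i :* (j :* y) :- j :* (i :* x)) refl i j x y)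
      (cong₂ ℚ._-_ (trans (cong (i ℚ.*_) (recipℚ-inverse y>0)) (ℚ.*-identityʳ i))
                   (trans (cong (j ℚ.*_) (recipℚ-inverse x>0)) (ℚ.*-identityʳ j))))
    ∣i-j∣≡ : ℚ.∣ i ℚ.- j ∣ ≡ (i ℚ.* j) ℚ.* ℚ.∣ x ℚ.- y ∣
    ∣i-j∣≡ = trans (cong ℚ.∣_∣ i-j≡) (trans (ℚ.∣p*q∣≡∣p∣*∣q∣ (i ℚ.* j) (y ℚ.- x))
      (cong₂ ℚ._*_ (ℚ.0≤p⇒∣p∣≡p (ℚ.<⇒≤ ij>0)) (∣p-q∣≡∣q-p∣ y x)))

infix  8 -_
infixl 7 _*_
infixl 6 _+_ _-_

_+_ : ℝ → ℝ → ℝ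
(x + y) .seq n  = seq x n ℚ.+ seq y n
(x + y) .cauchy = +-cauchy {seq x} {seq y} (cauchy x) (cauchy y)

_*_ : ℝ → ℝ → ℝ
(x * y) .seq n  = seq x n ℚ.* seq y n
(x * y) .cauchy = *-cauchy {seq x} {seq y} (cauchy x) (cauchy y)

-_ : ℝ → ℝ
(- x) .seq n  = ℚ.- seq x n
(- x) .cauchy = neg-cauchy {seq x} (cauchy x)

_-_ : ℝ → ℝ → ℝ
x - y = x + - y

∣_∣ : ℝ → ℝ
∣ x ∣ .seq n  = ℚ.∣ seq x n ∣
∣ x ∣ .cauchy = abs-cauchy {seq x} (cauchy x)

fromℚ : ℚ → ℝ
fromℚ p .seq _ = p
fromℚ p .cauchy ε ε>0 = 0 , λ _ _ _ _ →
  subst (λ r → ℚ.∣ r ∣ ℚ.< ε) (sym (ℚ.+-inverseʳ p)) ε>0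

fromℕ : ℕ → ℝ
fromℕ n = fromℚ (ℤ.+ n ℚ./ 1)

0ℝ 1ℝ : ℝ
0ℝ = fromℚ 0ℚ
1ℝ = fromℚ 1ℚ

ℝ-rawRing : RawRing 0ℓ 0ℓ
ℝ-rawRing = record
  { Carrier = ℝ ; _≈_ = _≈_ ; _+_ = _+_ ; _*_ = _*_ ; -_ = -_ ; 0# = 0ℝ ; 1# = 1ℝ }

open RawSemiringDefinitions (RawRing.rawSemiring ℝ-rawRing) public using (_^_; sum)

record ℝ⁺ : Set where
  constructor mkℝ⁺
  field
    val   : ℝ
    val>0 : 0ℝ < val

open ℝ⁺ public

mk>0 : ∀ {x} δ → 0ℚ ℚ.< δ → ∀ M → (∀ n → M ℕ.≤ n → δ ℚ.≤ seq x n) → 0ℝ < x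
mk>0 {x} δ δ>0 M h = mk< δ δ>0 M λ n hn →
  subst (δ ℚ.≤_) (sym (ℚ.+-identityʳ (seq x n))) (h n hn)

lower : ∀ {x} (x>0 : 0ℝ < x) → ∀ n → from x>0 ℕ.≤ n → gap x>0 ℚ.≤ seq x n
lower {x} x>0 n hn = subst (gap x>0 ℚ.≤_) (ℚ.+-identityʳ (seq x n)) (gap≤ x>0 n hn)

+>0 : ∀ {x y} → 0ℝ < x → 0ℝ < y → 0ℝ < x + y
+>0 x>0 y>0 = mk>0 (gap x>0 ℚ.+ gap y>0) (0<+ (gap>0 x>0) (ℚ.<⇒≤ (gap>0 y>0)))
  (from x>0 ℕ.⊔ from y>0) λ n hn →
    ℚ.+-mono-≤ (lower x>0 n (lub₁ hn)) (lower y>0 n (lub₂ {from x>0} hn))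

*>0 : ∀ {x y} → 0ℝ < x → 0ℝ < y → 0ℝ < x * y
*>0 x>0 y>0 = mk>0 (gap x>0 ℚ.* gap y>0) (0<* (gap>0 x>0) (gap>0 y>0))
  (from x>0 ℕ.⊔ from y>0) λ n hn →
    *-mono-≤ (ℚ.<⇒≤ (gap>0 x>0))
      (ℚ.<⇒≤ (ℚ.<-≤-trans (gap>0 y>0) (lower y>0 n (lub₂ {from x>0} hn))))
      (lower x>0 n (lub₁ hn)) (lower y>0 n (lub₂ {from x>0} hn))

1>0 : 0ℝ < 1ℝ
1>0 = mk>0 1ℚ (ℚ.positive⁻¹ 1ℚ) 0 λ _ _ → ℚ.≤-refl

^>0 : ∀ {x} → 0ℝ < x → ∀ m → 0ℝ < x ^ m
^>0 x>0 zero    = 1>0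
^>0 x>0 (suc m) = *>0 x>0 (^>0 x>0 m)

fromℕ+>0 : ∀ n {x} → 0ℝ < x → 0ℝ < fromℕ n + x
fromℕ+>0 n {x} x>0 = mk>0 (gap x>0) (gap>0 x>0) (from x>0) λ m hm →
  subst (ℚ._≤ ℤ.+ n ℚ./ 1 ℚ.+ seq x m) (ℚ.+-identityˡ (gap x>0))
    (ℚ.+-mono-≤ (ℚ.nonNegative⁻¹ (ℤ.+ n ℚ./ 1) {{ℚ.normalize-nonNeg n 1}}) (lower x>0 m hm))

infixl 6 _+⁺_
infix  7 _⊕_
infixr 8 _^⁺_
infixl 7 _/_

_+⁺_ : ℝ⁺ → ℝ⁺ → ℝ⁺
x +⁺ y = mkℝ⁺ (val x + val y) (+>0 (val>0 x) (val>0 y))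

_^⁺_ : ℝ⁺ → ℕ → ℝ⁺
x ^⁺ m = mkℝ⁺ (val x ^ m) (^>0 (val>0 x) m)

-- n ⊕ x is the sum n + x.
_⊕_ : ℕ → ℝ⁺ → ℝ⁺
n ⊕ x = mkℝ⁺ (fromℕ n + val x) (fromℕ+>0 n (val>0 x))

recip : ℝ⁺ → ℝ
recip y .seq n  = recipℚ (seq (val y) n)
recip y .cauchy =
  recip-cauchy {seq (val y)} (cauchy (val y)) (gap p) (gap>0 p) (from p) (lower p)
  where p = val>0 y

_/_ : ℝ → ℝ⁺ → ℝ
x / y = x * recip y

infix 4 _⟶_ _SumsTo_ ζE[_,_]≔_

_⟶_ : (ℕ → ℝ) → ℝ → Set
s ⟶ L = ∀ ε → 0ℝ < ε → ∃ λ M → ∀ n → M ℕ.≤ n → ∣ s n - L ∣ < ε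

-- f 0 + … + f (m ∸ 1)
∑<_ : ℕ → (ℕ → ℝ) → ℝ
(∑< m) f = sum {m} λ i → f (toℕ i)

-- f 1 + … + f m
∑₁≤_ : ℕ → (ℕ → ℝ) → ℝ
(∑₁≤ m) f = sum {m} λ i → f (suc (toℕ i))

_SumsTo_ : (ℕ → ℝ) → ℝ → Set
f SumsTo L = (λ m → (∑< m) f) ⟶ L

sgn : ℕ → ℝ
sgn n = (- 1ℝ) ^ n

-- ζE[ z , x ]≔ v says that the alternating Hurwitz zeta function, the series
-- Σ (-1)ⁿ / (n + x)ᶻ, converges at (z , x) with value v.  It is restricted to
-- exponents z ∈ ℕ and reals x > 0; it is meaningful for z ≥ 1 (at z = 0 the
-- series diverges, so that no v qualifies).
ζE[_,_]≔_ : ℕ → ℝ⁺ → ℝ → Set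
ζE[ z , x ]≔ v = (λ n → sgn n / (n ⊕ x) ^⁺ z) SumsTo v

{-# OPTIONS --safe #-}

-- Write x = (n + b)²ᵏ and y = (i + a)²ᵏ.  For odd N,
--   x⁻ᴺ/(x+y) + y⁻ᴺ/(x+y) = Σ_{1≤p≤N} (-1)ᵖ⁺¹ y⁻ᵖ x⁻⁽ᴺ⁻ᵖ⁺¹⁾,
-- and summing this with signs (-1)ⁿ⁺ⁱ over the square n, i < m turns the right-hand
-- side into the products of the m-th partial sums of the zeta series.  On the left
-- the square sums have the same limit as the iterated series: by the Leibniz
-- estimate, cutting every inner series at i = m changes the partial sum of the outer
-- series by O(m / (m + a)²ᵏ) (resp. with b), so no interchange of infinite sums
-- is needed.

module Submission where

open import Defs
open import Algebra.Bundles using (CommutativeRing)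
import Algebra.Properties.CommutativeSemiring.Exp as Exp
import Algebra.Properties.Semiring.Sum as Sum
open import Data.Fin.Base using (Fin; toℕ)
import Data.Integer.Base as ℤ
import Data.Integer.Properties as ℤ
open import Data.Nat.Base as ℕ using (ℕ; zero; suc; z≤n; s≤s)
open import Data.Nat.Coprimality as Coprime using (1-coprimeTo)
import Data.Nat.Properties as ℕ
import Data.Nat.Solver as ℕ-Solver
open import Data.Product.Base using (∃; _×_; _,_; proj₁; proj₂)
open import Data.Rational.Base as ℚ using (ℚ; 0ℚ; 1ℚ; ½)
import Data.Rational.Properties as ℚ
open import Data.Rational.Solver using (module +-*-Solver)
open import Data.Sum.Base using (inj₁; inj₂)
open import Level using (0ℓ)
open import Relation.Binary.Bundles using (Preorder)
open import Relation.Binary.PropositionalEquality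
  using (_≡_; refl; sym; trans; cong; cong₂; subst; subst₂)
import Relation.Binary.Reasoning.Preorder as PreorderReasoning
import Relation.Binary.Reasoning.Setoid as SetoidReasoning

open +-*-Solver using (solve; con; _:+_; _:*_; _:-_; :-_; _:=_)

-- The Leibniz remainder of an inner series cut at m is at most x/(x + y) with y = (m + a)²ᵏ. This
-- is not small uniformly in n: for fixed m it tends to 1 as n grows. The outer weight repairs it.
-- Its exponent 4k(q+1) equals 2k(N+1), so one factor x cancels the numerator, and what remains,
-- x⁻ᴺ/(x + y), is at most b⁻²ᵏᴺ/y for every n. As y ≥ m², the m errors add up to O(1/m). A real is
-- a Cauchy sequence of rationals, so each limit has to be constructed. `complete` does this from an
-- explicit tail bound, and returns the same bound as an error estimate for the limit. For the zeta
-- series and the inner series the tail bound is Leibniz's. The terms of the outer series are not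
-- shown to be monotone in absolute value; there the bound comes from absolute comparison with a
-- telescoping series, using that every inner sum is at most 1 in absolute value.

Eventually : (ℕ → Set) → Set
Eventually P = ∃ λ M → ∀ n → M ℕ.≤ n → P n

always : {P : ℕ → Set} → (∀ n → P n) → Eventually P
always p = 0 , λ n _ → p n

map-ev : {P Q : ℕ → Set} → (∀ n → P n → Q n) → Eventually P → Eventually Q
map-ev f (M , p) = M , λ n h → f n (p n h)

zip-ev : {P Q R : ℕ → Set} → (∀ n → P n → Q n → R n) →
  Eventually P → Eventually Q → Eventually R
zip-ev f (M , p) (M′ , q) = M ℕ.⊔ M′ , λ n h →
  f n (p n (ℕ.m⊔n≤o⇒m≤o M M′ h)) (q n (ℕ.m⊔n≤o⇒n≤o M M′ h))

-- Rational inequalities and the Archimedean property.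

p≤p+ε : ∀ p {ε} → 0ℚ ℚ.≤ ε → p ℚ.≤ p ℚ.+ ε
p≤p+ε p {ε} h = subst (ℚ._≤ p ℚ.+ ε) (ℚ.+-identityʳ p) (ℚ.+-monoʳ-≤ p h)

½ε+½ε : ∀ p ε → (p ℚ.+ ½ ℚ.* ε) ℚ.+ ½ ℚ.* ε ≡ p ℚ.+ ε
½ε+½ε p ε = trans (ℚ.+-assoc p _ _) (cong (p ℚ.+_) (½+½ ε))

½ε<ε : ∀ {ε} → 0ℚ ℚ.< ε → ½ ℚ.* ε ℚ.< ε
½ε<ε {ε} ε>0 = subst₂ ℚ._<_ (ℚ.+-identityʳ (½ ℚ.* ε)) (½+½ ε)
  (ℚ.+-monoʳ-< (½ ℚ.* ε) (½>0 ε>0))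

p≤∣p∣ : ∀ p → p ℚ.≤ ℚ.∣ p ∣
p≤∣p∣ p with ℚ.≤-total 0ℚ p
... | inj₁ h = ℚ.≤-reflexive (sym (ℚ.0≤p⇒∣p∣≡p h))
... | inj₂ h = ℚ.≤-trans h (ℚ.0≤∣p∣ p)

p-q≤r⇒p≤q+r : ∀ p q {r} → p ℚ.- q ℚ.≤ r → p ℚ.≤ q ℚ.+ r
p-q≤r⇒p≤q+r p q {r} h = subst (ℚ._≤ q ℚ.+ r)
  (solve 2 (λ p q → q :+ (p :- q) := p) refl p q) (ℚ.+-monoʳ-≤ q h)

∣p∣≤r : ∀ p {r} → p ℚ.≤ r → ℚ.- p ℚ.≤ r → ℚ.∣ p ∣ ℚ.≤ r
∣p∣≤r p h h′ with ℚ.∣p∣≡p∨∣p∣≡-p p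
... | inj₁ e = subst (ℚ._≤ _) (sym e) h
... | inj₂ e = subst (ℚ._≤ _) (sym e) h′

-- `ℚ./` normalises through a gcd and is stuck on a variable `n`; the explicit fraction exposes
-- numerator and denominator.
n/1 : ∀ n → ℤ.+ n ℚ./ 1 ≡ ℚ.mkℚ (ℤ.+ n) 0 (Coprime.sym (1-coprimeTo n))
n/1 n = ℚ.↥p/↧p≡p (ℚ.mkℚ (ℤ.+ n) 0 (Coprime.sym (1-coprimeTo n)))

suc/1 : ∀ n → ℤ.+ suc n ℚ./ 1 ≡ 1ℚ ℚ.+ ℤ.+ n ℚ./ 1
suc/1 n = trans (cong (λ i → i ℚ./ 1) (sym eq)) (cong (1ℚ ℚ.+_) (sym (n/1 n)))
  where
  eq : ℤ.+ 1 ℤ.* ℤ.+ 1 ℤ.+ ℤ.+ n ℤ.* ℤ.+ 1 ≡ ℤ.+ suc n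
  eq = cong (ℤ._+_ (ℤ.+ 1)) (ℤ.*-identityʳ (ℤ.+ n))

i≤∣i∣ : ∀ i → i ℤ.≤ ℤ.+ ℤ.∣ i ∣
i≤∣i∣ (ℤ.+ n)    = ℤ.≤-refl
i≤∣i∣ ℤ.-[1+ n ] = ℤ.-≤+

-- The absolute value of the numerator serves as threshold, since the denominator is at least 1.
archimedean : ∀ p → Eventually λ n → p ℚ.≤ ℤ.+ n ℚ./ 1
archimedean p@(ℚ.mkℚ i d c) = ℤ.∣ i ∣ , λ n h → subst (p ℚ.≤_) (sym (n/1 n))
  (ℚ.*≤* (subst₂ ℤ._≤_ (sym (ℤ.*-identityʳ i)) (ℤ.pos-* n (suc d))
    (ℤ.≤-trans (i≤∣i∣ i) (ℤ.+≤+ (ℕ.≤-trans h (ℕ.m≤m*n n (suc d)))))))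

-- The commutative ring of reals.

≡⇒≈ : ∀ {x y} → (∀ n → seq x n ≡ seq y n) → x ≈ y
≡⇒≈ {x} {y} h = mk≈ λ ε ε>0 → always λ n → subst (λ p → ℚ.∣ p ∣ ℚ.< ε)
  (sym (trans (cong (ℚ._- seq y n) (h n)) (ℚ.+-inverseʳ (seq y n)))) ε>0

≈-trans : ∀ {x y z} → x ≈ y → y ≈ z → x ≈ z
≈-trans {x} {y} {z} p q = mk≈ λ ε ε>0 → zip-ev
  (λ n u v → ℚ.≤-<-trans
    (subst (λ r → ℚ.∣ r ∣ ℚ.≤ ℚ.∣ seq x n ℚ.- seq y n ∣ ℚ.+ ℚ.∣ seq y n ℚ.- seq z n ∣)
      (solve 3 (λ x y z → (x :- y) :+ (y :- z) := x :- z) refl (seq x n) (seq y n) (seq z n))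
      (ℚ.∣p+q∣≤∣p∣+∣q∣ (seq x n ℚ.- seq y n) (seq y n ℚ.- seq z n)))
    (subst (_ ℚ.<_) (½+½ ε) (ℚ.+-mono-< u v)))
  (close p (½ ℚ.* ε) (½>0 ε>0)) (close q (½ ℚ.* ε) (½>0 ε>0))

+-cong : ∀ {x y u v} → x ≈ y → u ≈ v → x + u ≈ y + v
+-cong {x} {y} {u} {v} p q = mk≈ λ ε ε>0 → zip-ev
  (λ n r s → ℚ.≤-<-trans
    (subst (λ t → ℚ.∣ t ∣ ℚ.≤ ℚ.∣ seq x n ℚ.- seq y n ∣ ℚ.+ ℚ.∣ seq u n ℚ.- seq v n ∣)
      (solve 4 (λ x y u v → (x :- y) :+ (u :- v) := (x :+ u) :- (y :+ v)) refl
        (seq x n) (seq y n) (seq u n) (seq v n))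
      (ℚ.∣p+q∣≤∣p∣+∣q∣ (seq x n ℚ.- seq y n) (seq u n ℚ.- seq v n)))
    (subst (_ ℚ.<_) (½+½ ε) (ℚ.+-mono-< r s)))
  (close p (½ ℚ.* ε) (½>0 ε>0)) (close q (½ ℚ.* ε) (½>0 ε>0))

-- Since xu - yv = x(u - v) + v(x - y), eventual bounds for `x` and `v` suffice; each tolerance is
-- half of ε divided by the bound of the other factor.
*-cong : ∀ {x y u v} → x ≈ y → u ≈ v → x * u ≈ y * v
*-cong {x} {y} {u} {v} p q = mk≈ go
  where
  module _ (ε : ℚ) (ε>0 : 0ℚ ℚ.< ε) where
    bx = cauchy⇒bounded {seq x} (cauchy x)
    bv = cauchy⇒bounded {seq v} (cauchy v)
    B = proj₁ bx
    C = proj₁ bv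
    B>0 = proj₁ (proj₂ bx)
    C>0 = proj₁ (proj₂ bv)
    go : Eventually λ n → ℚ.∣ seq x n ℚ.* seq u n ℚ.- seq y n ℚ.* seq v n ∣ ℚ.< ε
    go = zip-ev
      (λ n h h′ → subst (_ ℚ.<_) (½+½ ε) (∣ac-bd∣< (seq x n) (seq y n) (seq u n) (seq v n) h h′))
      (zip-ev (λ n → ∣u*v∣< (seq x n) (seq u n ℚ.- seq v n) B>0) (proj₂ (proj₂ bx))
        (close q (recipℚ B ℚ.* (½ ℚ.* ε)) (0<* (recipℚ>0 B>0) (½>0 ε>0))))
      (zip-ev (λ n → ∣u*v∣< (seq v n) (seq x n ℚ.- seq y n) C>0) (proj₂ (proj₂ bv))
        (close p (recipℚ C ℚ.* (½ ℚ.* ε)) (0<* (recipℚ>0 C>0) (½>0 ε>0))))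

neg-cong : ∀ {x y} → x ≈ y → - x ≈ - y
neg-cong {x} {y} p = mk≈ λ ε ε>0 → map-ev
  (λ n → subst (ℚ._< ε) (trans (∣p-q∣≡∣q-p∣ (seq x n) (seq y n))
    (cong ℚ.∣_∣ (solve 2 (λ x y → y :- x := (:- x) :- (:- y)) refl (seq x n) (seq y n)))))
  (close p ε ε>0)

≈-sym : ∀ {x y} → x ≈ y → y ≈ x
≈-sym {x} {y} p = mk≈ λ ε ε>0 → map-ev
  (λ n → subst (ℚ._< ε) (∣p-q∣≡∣q-p∣ (seq x n) (seq y n))) (close p ε ε>0)

ℝ-commutativeRing : CommutativeRing 0ℓ 0ℓ
ℝ-commutativeRing = record
  { Carrier = ℝ ; _≈_ = _≈_ ; _+_ = _+_ ; _*_ = _*_ ; -_ = -_ ; 0# = 0ℝ ; 1# = 1ℝ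
  ; isCommutativeRing = record
    { isRing = record
      { +-isAbelianGroup = record
        { isGroup = record
          { isMonoid = record
            { isSemigroup = record
              { isMagma = record
                { isEquivalence = record
                  { refl = ≡⇒≈ λ _ → refl ; sym = ≈-sym ; trans = ≈-trans }
                ; ∙-cong = +-cong }
              ; assoc = λ x y z → ≡⇒≈ λ n → ℚ.+-assoc (seq x n) (seq y n) (seq z n) }
            ; identity = (λ x → ≡⇒≈ λ n → ℚ.+-identityˡ (seq x n))
                       , (λ x → ≡⇒≈ λ n → ℚ.+-identityʳ (seq x n)) }
          ; inverse = (λ x → ≡⇒≈ λ n → ℚ.+-inverseˡ (seq x n))
                    , (λ x → ≡⇒≈ λ n → ℚ.+-inverseʳ (seq x n))
          ; ⁻¹-cong = neg-cong }
        ; comm = λ x y → ≡⇒≈ λ n → ℚ.+-comm (seq x n) (seq y n) }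
      ; *-cong = *-cong
      ; *-assoc = λ x y z → ≡⇒≈ λ n → ℚ.*-assoc (seq x n) (seq y n) (seq z n)
      ; *-identity = (λ x → ≡⇒≈ λ n → ℚ.*-identityˡ (seq x n))
                   , (λ x → ≡⇒≈ λ n → ℚ.*-identityʳ (seq x n))
      ; distrib = (λ x y z → ≡⇒≈ λ n → ℚ.*-distribˡ-+ (seq x n) (seq y n) (seq z n))
                , (λ x y z → ≡⇒≈ λ n → ℚ.*-distribʳ-+ (seq x n) (seq y n) (seq z n)) }
    ; *-comm = λ x y → ≡⇒≈ λ n → ℚ.*-comm (seq x n) (seq y n) } }

open CommutativeRing ℝ-commutativeRing
  using (*-assoc; *-comm; *-identityˡ; *-identityʳ; +-identityʳ; +-assoc; +-comm)
  renaming (refl to ≈-refl)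
open Exp (CommutativeRing.commutativeSemiring ℝ-commutativeRing)
  using (^-congˡ; ^-congʳ; ^-homo-*; ^-assocʳ; ^-distrib-*)
open Sum (CommutativeRing.semiring ℝ-commutativeRing)
  using (sum-cong-≋; *-distribˡ-sum; *-distribʳ-sum; ∑-distrib-+; ∑-comm)

-- The order on the reals.

infix 4 _≤_

-- The slack ε makes the relation invariant under `_≈_`, which an eventual inequality between the
-- representatives would not be.
record _≤_ (x y : ℝ) : Set where
  constructor mk≤
  field
    bound : ∀ ε → 0ℚ ℚ.< ε → Eventually λ n → seq x n ℚ.≤ seq y n ℚ.+ ε

open _≤_ public

eventually-≤ : ∀ {x y} → Eventually (λ n → seq x n ℚ.≤ seq y n) → x ≤ y
eventually-≤ {x} {y} h = mk≤ λ ε ε>0 →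
  map-ev (λ n p → ℚ.≤-trans p (p≤p+ε (seq y n) (ℚ.<⇒≤ ε>0))) h

≈⇒≤ : ∀ {x y} → x ≈ y → x ≤ y
≈⇒≤ {x} {y} p = mk≤ λ ε ε>0 → map-ev
  (λ n h → p-q≤r⇒p≤q+r (seq x n) (seq y n) (ℚ.≤-trans (p≤∣p∣ _) (ℚ.<⇒≤ h)))
  (close p ε ε>0)

≤-refl : ∀ {x} → x ≤ x
≤-refl = eventually-≤ (always λ _ → ℚ.≤-refl)

≤-trans : ∀ {x y z} → x ≤ y → y ≤ z → x ≤ z
≤-trans {x} {y} {z} p q = mk≤ λ ε ε>0 → zip-ev
  (λ n u v → ℚ.≤-trans u (subst (seq y n ℚ.+ ½ ℚ.* ε ℚ.≤_) (½ε+½ε (seq z n) ε)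
    (ℚ.+-monoˡ-≤ (½ ℚ.* ε) v)))
  (bound p (½ ℚ.* ε) (½>0 ε>0)) (bound q (½ ℚ.* ε) (½>0 ε>0))

≤-antisym : ∀ {x y} → x ≤ y → y ≤ x → x ≈ y
≤-antisym {x} {y} p q = mk≈ λ ε ε>0 → zip-ev
  (λ n u v → ℚ.≤-<-trans
    (∣p∣≤r (seq x n ℚ.- seq y n) (diff (seq x n) (seq y n) u)
      (subst (ℚ._≤ ½ ℚ.* ε) (solve 2 (λ x y → y :- x := :- (x :- y)) refl (seq x n) (seq y n))
        (diff (seq y n) (seq x n) v)))
    (½ε<ε ε>0))
  (bound p (½ ℚ.* ε) (½>0 ε>0)) (bound q (½ ℚ.* ε) (½>0 ε>0))
  where
  diff : ∀ p q {r} → p ℚ.≤ q ℚ.+ r → p ℚ.- q ℚ.≤ r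
  diff p q {r} h = subst (p ℚ.- q ℚ.≤_)
    (solve 2 (λ q r → (q :+ r) :- q := r) refl q r) (ℚ.+-monoˡ-≤ (ℚ.- q) h)

+-mono-≤ : ∀ {x y u v} → x ≤ y → u ≤ v → x + u ≤ y + v
+-mono-≤ {x} {y} {u} {v} p q = mk≤ λ ε ε>0 → zip-ev
  (λ n r s → subst (seq x n ℚ.+ seq u n ℚ.≤_)
    (trans (solve 3 (λ y v e → (y :+ e) :+ (v :+ e) := (y :+ v) :+ e :+ e) refl
      (seq y n) (seq v n) (½ ℚ.* ε)) (½ε+½ε (seq y n ℚ.+ seq v n) ε))
    (ℚ.+-mono-≤ r s))
  (bound p (½ ℚ.* ε) (½>0 ε>0)) (bound q (½ ℚ.* ε) (½>0 ε>0))

neg-antimono-≤ : ∀ {x y} → x ≤ y → - y ≤ - x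
neg-antimono-≤ {x} {y} p = mk≤ λ ε ε>0 → map-ev
  (λ n h → subst₂ ℚ._≤_
    (solve 2 (λ x y → x :+ (:- x :- y) := :- y) refl (seq x n) (seq y n))
    (solve 3 (λ x y e → (y :+ e) :+ (:- x :- y) := :- x :+ e) refl (seq x n) (seq y n) ε)
    (ℚ.+-monoˡ-≤ (ℚ.- seq x n ℚ.- seq y n) h))
  (bound p ε ε>0)

-- Stronger than `0ℝ ≤ x`: a statement about the representative, without slack. It allows rational
-- inequalities to be multiplied entry by entry, and it holds for absolute values, positive reals,
-- their reciprocals and powers.
NonNegative : ℝ → Set
NonNegative x = Eventually λ n → 0ℚ ℚ.≤ seq x n

nonNeg⇒0≤ : ∀ {x} → NonNegative x → 0ℝ ≤ x
nonNeg⇒0≤ = eventually-≤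

*-nonNeg : ∀ {x y} → NonNegative x → NonNegative y → NonNegative (x * y)
*-nonNeg {x} {y} = zip-ev λ n p q → subst (ℚ._≤ seq x n ℚ.* seq y n) (ℚ.*-zeroˡ 0ℚ)
  (*-mono-≤ ℚ.≤-refl q p q)

*-monoʳ-≤ : ∀ {z x y} → NonNegative z → x ≤ y → z * x ≤ z * y
*-monoʳ-≤ {z} {x} {y} z≥0 p = mk≤ λ ε ε>0 → zip-ev
  (λ n f h → f h)
  (zip-ev (λ n z≥0 z≤B h → ℚ.≤-trans
      (ℚ.*-monoˡ-≤-nonNeg (seq z n) {{ℚ.nonNegative z≥0}} h)
      (subst (ℚ._≤ seq z n ℚ.* seq y n ℚ.+ ε) (sym (ℚ.*-distribˡ-+ (seq z n) (seq y n) _))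
        (ℚ.+-monoʳ-≤ (seq z n ℚ.* seq y n) (subst (seq z n ℚ.* (recipℚ B ℚ.* ε) ℚ.≤_) (B*r*ε ε)
          (ℚ.*-monoʳ-≤-nonNeg (recipℚ B ℚ.* ε) {{ℚ.nonNegative (ℚ.<⇒≤ (0<* (recipℚ>0 B>0) ε>0))}}
            (ℚ.≤-trans (p≤∣p∣ (seq z n)) z≤B))))))
    z≥0 (proj₂ (proj₂ bz)))
  -- Multiplication by `z` enlarges the slack by at most the bound `B` of `z`, so ε/B is asked for.
  (bound p (recipℚ B ℚ.* ε) (0<* (recipℚ>0 B>0) ε>0))
  where
  bz = cauchy⇒bounded {seq z} (cauchy z)
  B = proj₁ bz
  B>0 = proj₁ (proj₂ bz)
  B*r*ε : ∀ ε → B ℚ.* (recipℚ B ℚ.* ε) ≡ ε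
  B*r*ε ε = trans (sym (ℚ.*-assoc B (recipℚ B) ε))
    (trans (cong (ℚ._* ε) (trans (ℚ.*-comm B (recipℚ B)) (recipℚ-inverse B>0))) (ℚ.*-identityˡ ε))

≤-preorder : Preorder 0ℓ 0ℓ 0ℓ
≤-preorder = record
  { Carrier = ℝ ; _≈_ = _≈_ ; _≲_ = _≤_
  ; isPreorder = record
    { isEquivalence = CommutativeRing.isEquivalence ℝ-commutativeRing
    ; reflexive = ≈⇒≤
    ; trans = ≤-trans } }

module ≤-Reasoning = PreorderReasoning ≤-preorder

fromℚ-mono-≤ : ∀ {p q} → p ℚ.≤ q → fromℚ p ≤ fromℚ q
fromℚ-mono-≤ h = eventually-≤ (always λ _ → h)

+-≤-fromℚ : ∀ {x y p q} → x ≤ fromℚ p → y ≤ fromℚ q → x + y ≤ fromℚ (p ℚ.+ q)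
+-≤-fromℚ h h′ = ≤-trans (+-mono-≤ h h′) (≈⇒≤ (≡⇒≈ λ _ → refl))

fromℚ-cancel-≤ : ∀ {p q} → fromℚ p ≤ fromℚ q → p ℚ.≤ q
fromℚ-cancel-≤ {p} {q} h = ℚ.≮⇒≥ λ q<p →
  let d>0 = subst (ℚ._< p ℚ.- q) (ℚ.+-inverseʳ q) (ℚ.+-monoˡ-< (ℚ.- q) q<p)
      M , b = bound h (½ ℚ.* (p ℚ.- q)) (½>0 d>0)
  in ℚ.<-irrefl refl (ℚ.≤-<-trans (b M ℕ.≤-refl) (subst (q ℚ.+ ½ ℚ.* (p ℚ.- q) ℚ.<_)
       (solve 2 (λ p q → q :+ (p :- q) := p) refl p q)
       (ℚ.+-monoʳ-< q (½ε<ε d>0))))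

≤-approx : ∀ {x y} → (∀ ε → 0ℚ ℚ.< ε → x ≤ y + fromℚ ε) → x ≤ y
≤-approx {x} {y} h = mk≤ λ ε ε>0 →
  map-ev (λ n → subst (seq x n ℚ.≤_) (½ε+½ε (seq y n) ε))
    (bound (h (½ ℚ.* ε) (½>0 ε>0)) (½ ℚ.* ε) (½>0 ε>0))

≤-bounded : ∀ x → ∃ λ B → 0ℚ ℚ.< B × x ≤ fromℚ B
≤-bounded x = let B , B>0 , b = cauchy⇒bounded {seq x} (cauchy x)
  in B , B>0 , eventually-≤ (map-ev (λ n → ℚ.≤-trans (p≤∣p∣ (seq x n))) b)

-- Absolute values.

∣x∣-nonNeg : ∀ x → NonNegative ∣ x ∣
∣x∣-nonNeg x = always λ n → ℚ.0≤∣p∣ (seq x n)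

nonNeg⇒∣x∣≈x : ∀ {x} → NonNegative x → ∣ x ∣ ≈ x
nonNeg⇒∣x∣≈x {x} h = ≤-antisym
  (eventually-≤ (map-ev (λ n p → ℚ.≤-reflexive (ℚ.0≤p⇒∣p∣≡p p)) h))
  (eventually-≤ (always λ n → p≤∣p∣ (seq x n)))

∣x∣≤y : ∀ {x y} → x ≤ y → - x ≤ y → ∣ x ∣ ≤ y
∣x∣≤y {x} {y} p q = mk≤ λ ε ε>0 →
  zip-ev (λ n → ∣p∣≤r (seq x n)) (bound p ε ε>0) (bound q ε ε>0)

∣∣-cong : ∀ {x y} → x ≈ y → ∣ x ∣ ≈ ∣ y ∣
∣∣-cong {x} {y} p = mk≈ λ ε ε>0 → map-ev
  (λ n → ℚ.≤-<-trans (∣∣p∣-∣q∣∣≤∣p-q∣ (seq x n) (seq y n))) (close p ε ε>0)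

∣x+y∣≤∣x∣+∣y∣ : ∀ x y → ∣ x + y ∣ ≤ ∣ x ∣ + ∣ y ∣
∣x+y∣≤∣x∣+∣y∣ x y = eventually-≤ (always λ n → ℚ.∣p+q∣≤∣p∣+∣q∣ (seq x n) (seq y n))

∣x*y∣≈∣x∣*∣y∣ : ∀ x y → ∣ x * y ∣ ≈ ∣ x ∣ * ∣ y ∣
∣x*y∣≈∣x∣*∣y∣ x y = ≡⇒≈ λ n → ℚ.∣p*q∣≡∣p∣*∣q∣ (seq x n) (seq y n)

∣x-y∣≈∣y-x∣ : ∀ x y → ∣ x - y ∣ ≈ ∣ y - x ∣
∣x-y∣≈∣y-x∣ x y = ≡⇒≈ λ n → ∣p-q∣≡∣q-p∣ (seq x n) (seq y n)

∣x-z∣≤∣x-y∣+∣y-z∣ : ∀ x y z → ∣ x - z ∣ ≤ ∣ x - y ∣ + ∣ y - z ∣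
∣x-z∣≤∣x-y∣+∣y-z∣ x y z = ≤-trans
  (≈⇒≤ (∣∣-cong (≡⇒≈ λ n → solve 3 (λ x y z → x :- z := (x :- y) :+ (y :- z)) refl
    (seq x n) (seq y n) (seq z n))))
  (∣x+y∣≤∣x∣+∣y∣ (x - y) (y - z))

∣x-y∣≤0⇒x≈y : ∀ {x y} → ∣ x - y ∣ ≤ 0ℝ → x ≈ y
∣x-y∣≤0⇒x≈y p = mk≈ λ ε ε>0 → map-ev
  (λ n h → ℚ.≤-<-trans h (subst (ℚ._< ε) (sym (ℚ.+-identityˡ (½ ℚ.* ε))) (½ε<ε ε>0)))
  (bound p (½ ℚ.* ε) (½>0 ε>0))

-- Null sequences and limits.

Null : (ℕ → ℝ) → Set
Null r = ∀ ε → 0ℚ ℚ.< ε → Eventually λ n → r n ≤ fromℚ ε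

-- Working form of `_⟶_`, with rational tolerances and the non-strict order. `Null` bounds from
-- above only, which is enough for absolute values and for bounds of absolute values.
Limit : (ℕ → ℝ) → ℝ → Set
Limit s L = Null λ n → ∣ s n - L ∣

null-≤ : ∀ {r t} → Eventually (λ n → r n ≤ t n) → Null t → Null r
null-≤ h t↓ ε ε>0 = zip-ev (λ n → ≤-trans) h (t↓ ε ε>0)

null-+ : ∀ {r t} → Null r → Null t → Null λ n → r n + t n
null-+ r↓ t↓ ε ε>0 = zip-ev
  (λ n p q → ≤-trans (+-mono-≤ p q) (eventually-≤ (always λ _ → ℚ.≤-reflexive (½+½ ε))))
  (r↓ (½ ℚ.* ε) (½>0 ε>0)) (t↓ (½ ℚ.* ε) (½>0 ε>0))

null-* : ∀ c {r} → NonNegative c → Null r → Null λ n → c * r n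
null-* c {r} c≥0 r↓ ε ε>0 = map-ev
  (λ n h → let open ≤-Reasoning in begin
    c * r n                    ≲⟨ *-monoʳ-≤ c≥0 h ⟩
    c * fromℚ δ                ≈⟨ *-comm c (fromℚ δ) ⟩
    fromℚ δ * c                ≲⟨ *-monoʳ-≤ (always λ _ → ℚ.<⇒≤ δ>0) c≤B ⟩
    fromℚ δ * fromℚ B          ≈⟨ (≡⇒≈ λ _ → δ*B) ⟩
    fromℚ ε                    ∎)
  (r↓ δ δ>0)
  where
  B = proj₁ (≤-bounded c)
  B>0 = proj₁ (proj₂ (≤-bounded c))
  c≤B = proj₂ (proj₂ (≤-bounded c))
  δ = ε ℚ.* recipℚ B
  δ>0 = 0<* ε>0 (recipℚ>0 B>0)
  δ*B : δ ℚ.* B ≡ ε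
  δ*B = trans (ℚ.*-assoc ε (recipℚ B) B)
    (trans (cong (ε ℚ.*_) (recipℚ-inverse B>0)) (ℚ.*-identityʳ ε))

n/1>0 : ∀ n → 0ℚ ℚ.< ℤ.+ suc n ℚ./ 1
n/1>0 n = ℚ.positive⁻¹ _ {{ℚ.normalize-pos (suc n) 1}}

-- From r n ≤ C/n: with a rational bound `B` of `C`, every n ≥ 1 with n ≥ B/ε will do. All concrete
-- decay estimates are brought to this form.
n*r≤C⇒null : ∀ {r} C → (∀ n → 1 ℕ.≤ n → fromℕ n * r n ≤ C) → Null r
n*r≤C⇒null {r} C h ε ε>0 = zip-ev small (archimedean (recipℚ ε ℚ.* B)) (1 , λ _ p → p)
  where
  B = proj₁ (≤-bounded C)
  B>0 = proj₁ (proj₂ (≤-bounded C))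
  C≤B = proj₂ (proj₂ (≤-bounded C))
  small : ∀ n → recipℚ ε ℚ.* B ℚ.≤ ℤ.+ n ℚ./ 1 → 1 ℕ.≤ n → r n ≤ fromℚ ε
  small (suc n) B≤nε 1≤n = let open ≤-Reasoning in begin
    r (suc n)                               ≈⟨ (≡⇒≈ λ m → r≡ (seq (r (suc n)) m)) ⟩
    fromℚ δ * (fromℕ (suc n) * r (suc n))   ≲⟨ *-monoʳ-≤ δ≥0 (h (suc n) 1≤n) ⟩
    fromℚ δ * C                             ≲⟨ *-monoʳ-≤ δ≥0 C≤B ⟩
    fromℚ δ * fromℚ B                       ≲⟨ eventually-≤ (always λ _ → δB≤ε) ⟩
    fromℚ ε                                 ∎
    where
    N = ℤ.+ suc n ℚ./ 1
    δ = recipℚ N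
    δ>0 = recipℚ>0 (n/1>0 n)
    δ≥0 : NonNegative (fromℚ δ)
    δ≥0 = always λ _ → ℚ.<⇒≤ δ>0
    r≡ : ∀ x → x ≡ δ ℚ.* (N ℚ.* x)
    r≡ x = sym (trans (sym (ℚ.*-assoc δ N x))
      (trans (cong (ℚ._* x) (recipℚ-inverse (n/1>0 n))) (ℚ.*-identityˡ x)))
    δB≤ε : δ ℚ.* B ℚ.≤ ε
    δB≤ε = subst₂ ℚ._≤_
      (trans (solve 4 (λ d e i b → (d :* (i :* b)) :* e := (d :* b) :* (i :* e)) refl δ ε (recipℚ ε) B)
        (trans (cong ((δ ℚ.* B) ℚ.*_) (recipℚ-inverse ε>0)) (ℚ.*-identityʳ _)))
      (trans (cong (ℚ._* ε) (recipℚ-inverse (n/1>0 n))) (ℚ.*-identityˡ ε))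
      (ℚ.*-monoʳ-≤-nonNeg ε {{ℚ.nonNegative (ℚ.<⇒≤ ε>0)}}
        (ℚ.*-monoˡ-≤-nonNeg δ {{ℚ.nonNegative (ℚ.<⇒≤ δ>0)}} B≤nε))

limit-cong : ∀ {s t L} → (∀ n → s n ≈ t n) → Limit s L → Limit t L
limit-cong {s} {t} {L} h = null-≤ (always λ n →
  ≈⇒≤ (∣∣-cong (+-cong (≈-sym (h n)) ≈-refl)))

limit-const : ∀ c → Limit (λ _ → c) c
limit-const c ε ε>0 = always λ _ → eventually-≤ (always λ n →
  subst (ℚ._≤ ε) (sym (cong ℚ.∣_∣ (ℚ.+-inverseʳ (seq c n)))) (ℚ.<⇒≤ ε>0))

limit-+ : ∀ {s t K L} → Limit s K → Limit t L → Limit (λ n → s n + t n) (K + L)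
limit-+ {s} {t} {K} {L} s→ t→ = null-≤
  (always λ n → ≤-trans
    (≈⇒≤ (∣∣-cong (≡⇒≈ λ m → solve 4 (λ s t k l → s :+ t :- (k :+ l) := (s :- k) :+ (t :- l)) refl
      (seq (s n) m) (seq (t n) m) (seq K m) (seq L m))))
    (∣x+y∣≤∣x∣+∣y∣ (s n - K) (t n - L)))
  (null-+ s→ t→)

limit-* : ∀ {s t K L} → Limit s K → Limit t L → Limit (λ n → s n * t n) (K * L)
limit-* {s} {t} {K} {L} s→ t→ = null-≤
  (map-ev (λ n s-K≤1 → let open ≤-Reasoning in begin
      ∣ s n * t n - K * L ∣
        ≈⟨ ∣∣-cong (≡⇒≈ λ m → solve 4
             (λ s t k l → s :* t :- k :* l := (t :- l) :* (s :- k) :+ (k :* (t :- l) :+ l :* (s :- k)))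
             refl (seq (s n) m) (seq (t n) m) (seq K m) (seq L m)) ⟩
      ∣ (t n - L) * (s n - K) + (K * (t n - L) + L * (s n - K)) ∣
        ≲⟨ ≤-trans (∣x+y∣≤∣x∣+∣y∣ _ _) (+-mono-≤ ≤-refl (∣x+y∣≤∣x∣+∣y∣ _ _)) ⟩
      ∣ (t n - L) * (s n - K) ∣ + (∣ K * (t n - L) ∣ + ∣ L * (s n - K) ∣)
        ≈⟨ +-cong (∣x*y∣≈∣x∣*∣y∣ _ _) (+-cong (∣x*y∣≈∣x∣*∣y∣ _ _) (∣x*y∣≈∣x∣*∣y∣ _ _)) ⟩
      ∣ t n - L ∣ * ∣ s n - K ∣ + (∣ K ∣ * ∣ t n - L ∣ + ∣ L ∣ * ∣ s n - K ∣)
        ≲⟨ +-mono-≤ (*-monoʳ-≤ (∣x∣-nonNeg (t n - L)) s-K≤1) ≤-refl ⟩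
      ∣ t n - L ∣ * 1ℝ + (∣ K ∣ * ∣ t n - L ∣ + ∣ L ∣ * ∣ s n - K ∣)
        ≈⟨ +-cong (≡⇒≈ λ m → ℚ.*-identityʳ (seq ∣ t n - L ∣ m)) ≈-refl ⟩
      ∣ t n - L ∣ + (∣ K ∣ * ∣ t n - L ∣ + ∣ L ∣ * ∣ s n - K ∣) ∎)
    -- The tolerance 1 is enough for `s`: it reduces the quadratic error term to ∣ t n - L ∣.
    (s→ 1ℚ (ℚ.positive⁻¹ 1ℚ)))
  (null-+ t→ (null-+ (null-* ∣ K ∣ (∣x∣-nonNeg K) t→) (null-* ∣ L ∣ (∣x∣-nonNeg L) s→)))

limit-sum : ∀ {m} {s : ℕ → Fin m → ℝ} {L : Fin m → ℝ} →
  (∀ i → Limit (λ n → s n i) (L i)) → Limit (λ n → sum (s n)) (sum L)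
limit-sum {zero}  h = limit-const 0ℝ
limit-sum {suc m} h = limit-+ (h Fin.zero) (limit-sum λ i → h (Fin.suc i))

limit-≤ : ∀ {s L c R} → Limit s L → Eventually (λ n → ∣ s n - c ∣ ≤ R) → ∣ L - c ∣ ≤ R
limit-≤ {s} {L} {c} {R} s→ h = ≤-approx λ ε ε>0 →
  let M , p = zip-ev (λ n u v → let open ≤-Reasoning in begin
                ∣ L - c ∣                       ≲⟨ ∣x-z∣≤∣x-y∣+∣y-z∣ L (s n) c ⟩
                ∣ L - s n ∣ + ∣ s n - c ∣       ≈⟨ +-cong (∣x-y∣≈∣y-x∣ L (s n)) ≈-refl ⟩
                ∣ s n - L ∣ + ∣ s n - c ∣       ≲⟨ +-mono-≤ u v ⟩
                fromℚ ε + R                     ≈⟨ +-comm (fromℚ ε) R ⟩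
                R + fromℚ ε                     ∎) (s→ ε ε>0) h
  in p M ℕ.≤-refl

limit-unique : ∀ {s K L} → Limit s K → Limit s L → K ≈ L
limit-unique {s} {K} {L} s→K s→L = ∣x-y∣≤0⇒x≈y (≤-approx λ ε ε>0 →
  ≤-trans (limit-≤ s→K (s→L ε ε>0)) (≈⇒≤ (≡⇒≈ λ _ → sym (ℚ.+-identityˡ ε))))

-- A positive real ε exceeds a rational gap `g`. The distance is made at most g/4, the slack of
-- `_≤_` costs another g/4 on representatives, and the remaining g/2 witnesses the strict
-- inequality.
limit⇒⟶ : ∀ {s L} → Limit s L → s ⟶ L
limit⇒⟶ {s} {L} s→ ε ε>0 = map-ev
  (λ n h → let M , b = zip-ev (λ m u v → gap-left (seq ∣ s n - L ∣ m) (seq ε m) u v)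
                         (bound h (½ ℚ.* (½ ℚ.* g)) (½>0 (½>0 g>0))) (from ε>0 , lower ε>0)
           in mk< (½ ℚ.* g) (½>0 g>0) M b)
  (s→ (½ ℚ.* (½ ℚ.* g)) (½>0 (½>0 g>0)))
  where
  g = gap ε>0
  g>0 = gap>0 ε>0
  gap-left : ∀ x e → x ℚ.≤ ½ ℚ.* (½ ℚ.* g) ℚ.+ ½ ℚ.* (½ ℚ.* g) → g ℚ.≤ e → ½ ℚ.* g ℚ.≤ e ℚ.- x
  gap-left x e u v = subst (ℚ._≤ e ℚ.- x)
    (trans (cong (λ h → g ℚ.- h) (½+½ (½ ℚ.* g)))
      (trans (cong (ℚ._- ½ ℚ.* g) (sym (½+½ g)))
        (solve 1 (λ h → h :+ h :- h := h) refl (½ ℚ.* g))))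
    (ℚ.+-mono-≤ v (ℚ.neg-antimono-≤ u))

-- Completeness, with an explicit error bound.

module _ {s r : ℕ → ℝ} (k : ℕ) (r↓ : Null r)
  (s≤r : ∀ n m → k ℕ.≤ n → ∣ s (n ℕ.+ m) - s n ∣ ≤ r n) where

  private
    δ : ℕ → ℚ
    δ j = recipℚ (ℤ.+ suc j ℚ./ 1)

    δ>0 : ∀ j → 0ℚ ℚ.< δ j
    δ>0 j = recipℚ>0 (n/1>0 j)

    δ≤ : ∀ ε → 0ℚ ℚ.< ε → Eventually λ j → δ j ℚ.≤ ε
    δ≤ ε ε>0 = let M , h = archimedean (recipℚ ε) in M , λ j M≤j → subst₂ ℚ._≤_
      (trans (ℚ.*-assoc (δ j) (recipℚ ε) ε)
        (trans (cong (δ j ℚ.*_) (recipℚ-inverse ε>0)) (ℚ.*-identityʳ (δ j))))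
      (ℚ.*-identityˡ ε)
      (ℚ.*-monoʳ-≤-nonNeg ε {{ℚ.nonNegative (ℚ.<⇒≤ ε>0)}}
        (recipℚ-lower (recipℚ>0 ε>0) (h (suc j) (ℕ.m≤n⇒m≤1+n M≤j))))

    N : ℕ → ℕ
    N j = proj₁ (r↓ (δ j) (δ>0 j)) ℕ.⊔ k

    K : ∀ j → _
    K j = cauchy (s (N j)) (δ j) (δ>0 j)

    -- Diagonal construction: the entry of the real `s (N j)` at its Cauchy modulus for `δ j`, hence
    -- a rational within `δ j` of it. Since `s n` stays within `δ j` of `s (N j)` for n ≥ `N j`, the
    -- total in `near` is 2 `δ j`.
    q : ℕ → ℚ
    q j = seq (s (N j)) (proj₁ (K j))

    near : ∀ j n → N j ℕ.≤ n → ∣ s n - fromℚ (q j) ∣ ≤ fromℚ (δ j ℚ.+ δ j)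
    near j n Nj≤n = ≤-trans (∣x-z∣≤∣x-y∣+∣y-z∣ (s n) (s (N j)) (fromℚ (q j)))
      (+-≤-fromℚ
        (≤-trans
          (subst (λ n → ∣ s n - s (N j) ∣ ≤ r (N j)) (ℕ.m+[n∸m]≡n Nj≤n)
            (s≤r (N j) (n ℕ.∸ N j) (ℕ.m≤n⊔m (proj₁ (r↓ (δ j) (δ>0 j))) k)))
          (proj₂ (r↓ (δ j) (δ>0 j)) (N j) (ℕ.m≤m⊔n _ k)))
        (eventually-≤ (proj₁ (K j) , λ m h → ℚ.<⇒≤ (proj₂ (K j) m (proj₁ (K j)) h ℕ.≤-refl))))

    q-close : ∀ i j → ℚ.∣ q i ℚ.- q j ∣ ℚ.≤ (δ i ℚ.+ δ i) ℚ.+ (δ j ℚ.+ δ j)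
    q-close i j = fromℚ-cancel-≤ (≤-trans
      (≤-trans (≈⇒≤ (≡⇒≈ λ _ → refl)) (∣x-z∣≤∣x-y∣+∣y-z∣ (fromℚ (q i)) (s n) (fromℚ (q j))))
      (+-≤-fromℚ (≤-trans (≈⇒≤ (∣x-y∣≈∣y-x∣ (fromℚ (q i)) (s n))) (near i n (ℕ.m≤m⊔n (N i) (N j))))
        (near j n (ℕ.m≤n⊔m (N i) (N j)))))
      where n = N i ℕ.⊔ N j

    -- `q-close` adds four terms δ; an eighth of ε for each gives ε/2, which leaves room for a
    -- strict inequality.
    ⅛ : ℚ → ℚ
    ⅛ ε = ½ ℚ.* (½ ℚ.* (½ ℚ.* ε))

    ⅛>0 : ∀ {ε} → 0ℚ ℚ.< ε → 0ℚ ℚ.< ⅛ ε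
    ⅛>0 ε>0 = ½>0 (½>0 (½>0 ε>0))

    ≤⅛⇒≤½ : ∀ {p q} ε → p ℚ.≤ ⅛ ε → q ℚ.≤ ⅛ ε → (p ℚ.+ p) ℚ.+ (q ℚ.+ q) ℚ.≤ ½ ℚ.* ε
    ≤⅛⇒≤½ ε h h′ = subst (_ ℚ.≤_)
      (trans (cong₂ ℚ._+_ (½+½ (½ ℚ.* (½ ℚ.* ε))) (½+½ (½ ℚ.* (½ ℚ.* ε)))) (½+½ (½ ℚ.* ε)))
      (ℚ.+-mono-≤ (ℚ.+-mono-≤ h h) (ℚ.+-mono-≤ h′ h′))

    q-near : ∀ ε → 0ℚ ℚ.< ε →
      ∃ λ J → ∀ i j → J ℕ.≤ i → J ℕ.≤ j → ℚ.∣ q i ℚ.- q j ∣ ℚ.≤ ½ ℚ.* ε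
    q-near ε ε>0 = let J , h = δ≤ (⅛ ε) (⅛>0 ε>0) in J , λ i j J≤i J≤j →
      ℚ.≤-trans (q-close i j) (≤⅛⇒≤½ ε (h i J≤i) (h j J≤j))

    L : ℝ
    L .seq = q
    L .cauchy ε ε>0 = let J , h = q-near ε ε>0 in J , λ i j J≤i J≤j → ℚ.≤-<-trans (h i j J≤i J≤j) (½ε<ε ε>0)

    s→L : Limit s L
    s→L ε ε>0 = let J , h = δ≤ (⅛ ε) (⅛>0 ε>0) in N J , λ n NJ≤n → ≤-trans (∣x-z∣≤∣x-y∣+∣y-z∣ (s n) (fromℚ (q J)) L)
      (≤-trans
        (+-≤-fromℚ
          (≤-trans (near J n NJ≤n) (fromℚ-mono-≤ (ℚ.≤-trans
            (p≤p+ε (δ J ℚ.+ δ J) (ℚ.<⇒≤ (0<+ (δ>0 J) (ℚ.<⇒≤ (δ>0 J)))))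
            (≤⅛⇒≤½ ε (h J ℕ.≤-refl) (h J ℕ.≤-refl)))))
          (eventually-≤ {y = fromℚ (½ ℚ.* ε)} (J , λ i J≤i →
            ℚ.≤-trans (q-close J i) (≤⅛⇒≤½ ε (h J ℕ.≤-refl) (h i J≤i)))))
        (≈⇒≤ (≡⇒≈ λ _ → ½+½ ε)))

  -- The error bound follows by letting the far index of the tail estimate tend to infinity in
  -- `limit-≤`.
  complete : ∃ λ L → Limit s L × ∀ n → k ℕ.≤ n → ∣ L - s n ∣ ≤ r n
  complete = L , s→L , λ n k≤n → limit-≤ s→L (n , λ m n≤m →
    subst (λ m → ∣ s m - s n ∣ ≤ r n) (ℕ.m+[n∸m]≡n n≤m) (s≤r n (m ℕ.∸ n) k≤n))

-- Powers and reciprocals.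

module ≈-Reasoning = SetoidReasoning (CommutativeRing.setoid ℝ-commutativeRing)

eventually-≡⇒≈ : ∀ {x y} → Eventually (λ n → seq x n ≡ seq y n) → x ≈ y
eventually-≡⇒≈ h = ≤-antisym
  (eventually-≤ (map-ev (λ _ e → ℚ.≤-reflexive e) h))
  (eventually-≤ (map-ev (λ _ e → ℚ.≤-reflexive (sym e)) h))

y≤x⇒0≤x-y : ∀ {x y} → y ≤ x → 0ℝ ≤ x - y
y≤x⇒0≤x-y {x} {y} h = ≤-trans
  (≈⇒≤ (≡⇒≈ λ n → sym (ℚ.+-inverseʳ (seq y n)))) (+-mono-≤ h ≤-refl)

0≤y⇒x-y≤x : ∀ {x y} → 0ℝ ≤ y → x - y ≤ x
0≤y⇒x-y≤x {x} h = ≤-trans (+-mono-≤ ≤-refl (neg-antimono-≤ h))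
  (≈⇒≤ (≡⇒≈ λ n → ℚ.+-identityʳ (seq x n)))

*-mono₂-≤ : ∀ {x y u v} → NonNegative x → NonNegative v → x ≤ y → u ≤ v → x * u ≤ y * v
*-mono₂-≤ {x} {y} {u} {v} x≥0 v≥0 x≤y u≤v = begin
  x * u ≲⟨ *-monoʳ-≤ x≥0 u≤v ⟩
  x * v ≈⟨ *-comm x v ⟩
  v * x ≲⟨ *-monoʳ-≤ v≥0 x≤y ⟩
  v * y ≈⟨ *-comm v y ⟩
  y * v ∎
  where open ≤-Reasoning

1ℝ-nonNeg : NonNegative 1ℝ
1ℝ-nonNeg = always λ _ → ℚ.<⇒≤ (ℚ.positive⁻¹ 1ℚ)

^-nonNeg : ∀ {x} m → NonNegative x → NonNegative (x ^ m)
^-nonNeg zero    h = 1ℝ-nonNeg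
^-nonNeg {x} (suc m) h = *-nonNeg {x} {x ^ m} h (^-nonNeg m h)

^-monoˡ-≤ : ∀ {x y} m → NonNegative x → NonNegative y → x ≤ y → x ^ m ≤ y ^ m
^-monoˡ-≤ zero    x≥0 y≥0 h = ≤-refl
^-monoˡ-≤ (suc m) x≥0 y≥0 h = *-mono₂-≤ x≥0 (^-nonNeg m y≥0) h (^-monoˡ-≤ m x≥0 y≥0 h)

^-monoʳ-≤ : ∀ {x m n} → NonNegative x → 1ℝ ≤ x → m ℕ.≤ n → x ^ m ≤ x ^ n
^-monoʳ-≤ {n = zero} x≥0 1≤x z≤n = ≤-refl
^-monoʳ-≤ {x} {n = suc n} x≥0 1≤x z≤n = ≤-trans (≈⇒≤ (≈-sym (*-identityˡ 1ℝ)))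
  (*-mono₂-≤ 1ℝ-nonNeg (^-nonNeg n x≥0) 1≤x (^-monoʳ-≤ {n = n} x≥0 1≤x z≤n))
^-monoʳ-≤ x≥0 1≤x (s≤s m≤n) = *-monoʳ-≤ x≥0 (^-monoʳ-≤ x≥0 1≤x m≤n)

val-nonNeg : ∀ y → NonNegative (val y)
val-nonNeg y = from (val>0 y) , λ n h →
  ℚ.≤-trans (ℚ.<⇒≤ (gap>0 (val>0 y))) (lower (val>0 y) n h)

val-seq>0 : ∀ y → Eventually λ n → 0ℚ ℚ.< seq (val y) n
val-seq>0 y = from (val>0 y) , λ n h → ℚ.<-≤-trans (gap>0 (val>0 y)) (lower (val>0 y) n h)

recip-nonNeg : ∀ y → NonNegative (recip y)
recip-nonNeg y = map-ev (λ _ h → ℚ.<⇒≤ (recipℚ>0 h)) (val-seq>0 y)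

recip-inverse : ∀ y → recip y * val y ≈ 1ℝ
recip-inverse y = eventually-≡⇒≈ (map-ev (λ _ → recipℚ-inverse) (val-seq>0 y))

recip-unique : ∀ x y → x * val y ≈ 1ℝ → x ≈ recip y
recip-unique x y h = begin
  x                       ≈⟨ *-identityʳ x ⟨
  x * 1ℝ                  ≈⟨ *-cong (≈-refl {x}) (recip-inverse y) ⟨
  x * (recip y * val y)   ≈⟨ (≡⇒≈ λ n → solve 3 (λ x r v → x :* (r :* v) := (x :* v) :* r) refl
                                (seq x n) (seq (recip y) n) (seq (val y) n)) ⟩
  x * val y * recip y     ≈⟨ *-cong h ≈-refl ⟩
  1ℝ * recip y            ≈⟨ *-identityˡ (recip y) ⟩
  recip y                 ∎
  where open ≈-Reasoning

recip-antimono-≤ : ∀ x y → val x ≤ val y → recip y ≤ recip x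
recip-antimono-≤ x y h = begin
  recip y                         ≈⟨ *-identityʳ (recip y) ⟨
  recip y * 1ℝ                    ≈⟨ *-cong (≈-refl {recip y}) (recip-inverse x) ⟨
  recip y * (recip x * val x)     ≲⟨ *-monoʳ-≤ (recip-nonNeg y) (*-monoʳ-≤ (recip-nonNeg x) h) ⟩
  recip y * (recip x * val y)     ≈⟨ (≡⇒≈ λ n → solve 3 (λ r s v → r :* (s :* v) := s :* (r :* v)) refl
                                       (seq (recip y) n) (seq (recip x) n) (seq (val y) n)) ⟩
  recip x * (recip y * val y)     ≈⟨ *-cong (≈-refl {recip x}) (recip-inverse y) ⟩
  recip x * 1ℝ                    ≈⟨ *-identityʳ (recip x) ⟩
  recip x                         ∎
  where open ≤-Reasoning

1^n≈1 : ∀ n → 1ℝ ^ n ≈ 1ℝ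
1^n≈1 zero    = ≈-refl
1^n≈1 (suc n) = ≈-trans (*-identityˡ (1ℝ ^ n)) (1^n≈1 n)

recip-^-* : ∀ x m n → recip (x ^⁺ (m ℕ.* n)) ≈ recip (x ^⁺ m) ^ n
recip-^-* x m n = ≈-sym (recip-unique (recip (x ^⁺ m) ^ n) (x ^⁺ (m ℕ.* n)) (begin
  recip (x ^⁺ m) ^ n * val x ^ (m ℕ.* n)   ≈⟨ *-cong ≈-refl (^-assocʳ (val x) m n) ⟨
  recip (x ^⁺ m) ^ n * (val x ^ m) ^ n     ≈⟨ ^-distrib-* (recip (x ^⁺ m)) (val x ^ m) n ⟨
  (recip (x ^⁺ m) * val x ^ m) ^ n         ≈⟨ ^-congˡ n (recip-inverse (x ^⁺ m)) ⟩
  1ℝ ^ n                                   ≈⟨ 1^n≈1 n ⟩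
  1ℝ                                       ∎))
  where open ≈-Reasoning

-- Growth of the shifted powers (n + x)ʲ.

fromℕ-nonNeg : ∀ n → NonNegative (fromℕ n)
fromℕ-nonNeg n = always λ _ → ℚ.nonNegative⁻¹ (ℤ.+ n ℚ./ 1) {{ℚ.normalize-nonNeg n 1}}

fromℕ-suc : ∀ n → fromℕ (suc n) ≈ 1ℝ + fromℕ n
fromℕ-suc n = ≡⇒≈ λ _ → suc/1 n

1≤fromℕ : ∀ {n} → 1 ℕ.≤ n → 1ℝ ≤ fromℕ n
1≤fromℕ {suc n} h = begin
  1ℝ             ≈⟨ +-identityʳ 1ℝ ⟨
  1ℝ + 0ℝ        ≲⟨ +-mono-≤ ≤-refl (nonNeg⇒0≤ (fromℕ-nonNeg n)) ⟩
  1ℝ + fromℕ n   ≈⟨ fromℕ-suc n ⟨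
  fromℕ (suc n)  ∎
  where open ≤-Reasoning

fromℕ≤⊕ : ∀ n x → fromℕ n ≤ val (n ⊕ x)
fromℕ≤⊕ n x = ≤-trans (≈⇒≤ (≈-sym (+-identityʳ (fromℕ n))))
  (+-mono-≤ ≤-refl (nonNeg⇒0≤ (val-nonNeg x)))

suc-⊕ : ∀ n x → val (suc n ⊕ x) ≈ 1ℝ + val (n ⊕ x)
suc-⊕ n x = ≈-trans (+-cong (fromℕ-suc n) ≈-refl) (+-assoc 1ℝ (fromℕ n) (val x))

⊕≤suc-⊕ : ∀ n x → val (n ⊕ x) ≤ val (suc n ⊕ x)
⊕≤suc-⊕ n x = begin
  val (n ⊕ x)           ≈⟨ (≡⇒≈ λ m → sym (ℚ.+-identityˡ (seq (val (n ⊕ x)) m))) ⟩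
  0ℝ + val (n ⊕ x)      ≲⟨ +-mono-≤ (nonNeg⇒0≤ 1ℝ-nonNeg) ≤-refl ⟩
  1ℝ + val (n ⊕ x)      ≈⟨ suc-⊕ n x ⟨
  val (suc n ⊕ x)       ∎
  where open ≤-Reasoning

1≤⊕ : ∀ {n} x → 1 ℕ.≤ n → 1ℝ ≤ val (n ⊕ x)
1≤⊕ {n} x h = ≤-trans (1≤fromℕ h) (fromℕ≤⊕ n x)

-- For n ≥ 1 the base n + x is at least 1, so a larger exponent only helps. At n = 0 the base may be
-- below 1, which is why the growth and decay estimates start at n = 1.
fromℕ^≤⊕^ : ∀ {n i j} x → 1 ℕ.≤ n → i ℕ.≤ j → fromℕ n ^ i ≤ val ((n ⊕ x) ^⁺ j)
fromℕ^≤⊕^ {n} {i} x 1≤n i≤j = ≤-trans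
  (^-monoˡ-≤ i (fromℕ-nonNeg n) (val-nonNeg (n ⊕ x)) (fromℕ≤⊕ n x))
  (^-monoʳ-≤ (val-nonNeg (n ⊕ x)) (1≤⊕ x 1≤n) i≤j)

fromℕ≤⊕^ : ∀ {n j} x → 1 ℕ.≤ n → 1 ℕ.≤ j → fromℕ n ≤ val ((n ⊕ x) ^⁺ j)
fromℕ≤⊕^ {n} x 1≤n 1≤j = ≤-trans (≈⇒≤ (≈-sym (*-identityʳ (fromℕ n)))) (fromℕ^≤⊕^ x 1≤n 1≤j)

⊕^≤suc-⊕^ : ∀ n x j → val ((n ⊕ x) ^⁺ j) ≤ val ((suc n ⊕ x) ^⁺ j)
⊕^≤suc-⊕^ n x j = ^-monoˡ-≤ j (val-nonNeg (n ⊕ x)) (val-nonNeg (suc n ⊕ x)) (⊕≤suc-⊕ n x)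

-- Finite sums.

∑-cong : ∀ m {f g} → (∀ i → f i ≈ g i) → (∑< m) f ≈ (∑< m) g
∑-cong m h = sum-cong-≋ {m} λ i → h (toℕ i)

∑-mono-≤ : ∀ m {f g} → (∀ i → f i ≤ g i) → (∑< m) f ≤ (∑< m) g
∑-mono-≤ zero    h = ≤-refl
∑-mono-≤ (suc m) h = +-mono-≤ (h 0) (∑-mono-≤ m λ i → h (suc i))

∣∑∣≤∑∣∣ : ∀ m f → ∣ (∑< m) f ∣ ≤ (∑< m) λ i → ∣ f i ∣
∣∑∣≤∑∣∣ zero    f = ≈⇒≤ (≡⇒≈ λ _ → refl)
∣∑∣≤∑∣∣ (suc m) f = ≤-trans (∣x+y∣≤∣x∣+∣y∣ _ _) (+-mono-≤ ≤-refl (∣∑∣≤∑∣∣ m λ i → f (suc i)))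

∑-const : ∀ m c → (∑< m) (λ _ → c) ≈ fromℕ m * c
∑-const zero    c = ≡⇒≈ λ n → sym (ℚ.*-zeroˡ (seq c n))
∑-const (suc m) c = begin
  c + (∑< m) (λ _ → c)   ≈⟨ +-cong ≈-refl (∑-const m c) ⟩
  c + fromℕ m * c        ≈⟨ (≡⇒≈ λ n → solve 2 (λ c m → c :+ m :* c := (con 1ℚ :+ m) :* c) refl
                              (seq c n) (seq (fromℕ m) n)) ⟩
  (1ℝ + fromℕ m) * c     ≈⟨ *-cong (fromℕ-suc m) ≈-refl ⟨
  fromℕ (suc m) * c      ∎
  where open ≈-Reasoning

∑-split : ∀ m n f → (∑< (m ℕ.+ n)) f ≈ (∑< m) f + (∑< n) (λ i → f (m ℕ.+ i))
∑-split zero    n f = ≡⇒≈ λ k → sym (ℚ.+-identityˡ (seq ((∑< n) f) k))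
∑-split (suc m) n f = ≈-trans (+-cong ≈-refl (∑-split m n λ i → f (suc i)))
  (≈-sym (+-assoc _ _ _))

∑-tail : ∀ m n f → (∑< (m ℕ.+ n)) f - (∑< m) f ≈ (∑< n) (λ i → f (m ℕ.+ i))
∑-tail m n f = ≈-trans (+-cong (∑-split m n f) ≈-refl)
  (≡⇒≈ λ k → solve 2 (λ s t → (s :+ t) :- s := t) refl
    (seq ((∑< m) f) k) (seq ((∑< n) λ i → f (m ℕ.+ i)) k))

-- Alternating sums and the Leibniz criterion.

∣sgn∣≈1 : ∀ n → ∣ sgn n ∣ ≈ 1ℝ
∣sgn∣≈1 zero    = ≡⇒≈ λ _ → refl
∣sgn∣≈1 (suc n) = ≈-trans (∣x*y∣≈∣x∣*∣y∣ (- 1ℝ) (sgn n))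
  (≈-trans (*-cong (≡⇒≈ λ _ → refl) (∣sgn∣≈1 n)) (*-identityˡ 1ℝ))

∣sgn*x∣≈∣x∣ : ∀ n x → ∣ sgn n * x ∣ ≈ ∣ x ∣
∣sgn*x∣≈∣x∣ n x = ≈-trans (∣x*y∣≈∣x∣*∣y∣ (sgn n) x)
  (≈-trans (*-cong (∣sgn∣≈1 n) ≈-refl) (*-identityˡ ∣ x ∣))

alternating : (ℕ → ℝ) → ℕ → ℝ
alternating f m = (∑< m) λ i → sgn i * f i

alternating-shift : ∀ n m (f : ℕ → ℝ) →
  (∑< m) (λ i → sgn (n ℕ.+ i) * f (n ℕ.+ i)) ≈ sgn n * alternating (λ i → f (n ℕ.+ i)) m
alternating-shift n m f = ≈-trans
  (∑-cong m λ i → ≈-trans (*-cong (^-homo-* (- 1ℝ) n i) ≈-refl) (*-assoc (sgn n) (sgn i) (f (n ℕ.+ i))))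
  (≈-sym (*-distribˡ-sum {m} (sgn n) λ i → sgn (toℕ i) * f (n ℕ.+ toℕ i)))

alternating-suc : ∀ m f → alternating f (suc m) ≈ f 0 - alternating (λ i → f (suc i)) m
alternating-suc m f = ≈-trans
  (+-cong (*-identityˡ (f 0)) (alternating-shift 1 m f))
  (≡⇒≈ λ k → solve 2 (λ x y → x :+ (:- con 1ℚ :* con 1ℚ) :* y := x :- y) refl
    (seq (f 0) k) (seq (alternating (λ i → f (suc i)) m) k))

-- Splitting off the first term gives `f 0` minus an alternating sum that starts at `f 1`. The upper
-- bound of the shorter sum yields the lower bound of the longer one and conversely, so both are
-- proved together and no parity of `m` is distinguished.
alternating-bounds : ∀ m {f} → (∀ i → 0ℝ ≤ f i) → (∀ i → f (suc i) ≤ f i) →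
  0ℝ ≤ alternating f m × alternating f m ≤ f 0
alternating-bounds zero    f≥0 f↘ = ≤-refl , f≥0 0
alternating-bounds (suc m) {f} f≥0 f↘ =
  let 0≤A , A≤f1 = alternating-bounds m {λ i → f (suc i)} (λ i → f≥0 (suc i)) (λ i → f↘ (suc i))
  in ≤-trans (y≤x⇒0≤x-y (≤-trans A≤f1 (f↘ 0))) (≈⇒≤ (≈-sym (alternating-suc m f)))
   , ≤-trans (≈⇒≤ (alternating-suc m f)) (0≤y⇒x-y≤x 0≤A)

0≤x≤y⇒∣x∣≤y : ∀ {x y} → 0ℝ ≤ x → x ≤ y → ∣ x ∣ ≤ y
0≤x≤y⇒∣x∣≤y h h′ = ∣x∣≤y h′ (≤-trans (neg-antimono-≤ h)
  (≤-trans (≈⇒≤ (≡⇒≈ λ _ → refl)) (≤-trans h h′)))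

-- A block of terms starting at n is, up to sign, an alternating sum with first term `f n`, hence at
-- most `f n` in absolute value whatever its length. This is the tail bound that `complete`
-- requires.
leibniz : ∀ {f} → (∀ i → 0ℝ ≤ f i) → (∀ i → f (suc i) ≤ f i) → Null f →
  ∃ λ L → Limit (alternating f) L × ∀ n → 0 ℕ.≤ n → ∣ L - alternating f n ∣ ≤ f n
leibniz {f} f≥0 f↘ f↓ = complete 0 f↓ λ n m _ → begin
  ∣ alternating f (n ℕ.+ m) - alternating f n ∣
    ≈⟨ ∣∣-cong (≈-trans (∑-tail n m (λ i → sgn i * f i)) (alternating-shift n m f)) ⟩
  ∣ sgn n * alternating (λ i → f (n ℕ.+ i)) m ∣
    ≈⟨ ∣sgn*x∣≈∣x∣ n (alternating (λ i → f (n ℕ.+ i)) m) ⟩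
  ∣ alternating (λ i → f (n ℕ.+ i)) m ∣
    ≲⟨ (let 0≤A , A≤f = alternating-bounds m {λ i → f (n ℕ.+ i)} (λ i → f≥0 (n ℕ.+ i)) (shift n)
        in 0≤x≤y⇒∣x∣≤y 0≤A A≤f) ⟩
  f (n ℕ.+ 0)
    ≡⟨ cong f (ℕ.+-identityʳ n) ⟩
  f n ∎
  where
  open ≤-Reasoning
  shift : ∀ n i → f (n ℕ.+ suc i) ≤ f (n ℕ.+ i)
  shift n i = subst (λ k → f k ≤ f (n ℕ.+ i)) (sym (ℕ.+-suc n i)) (f↘ (n ℕ.+ i))

-- Convergence of the zeta series.

ζ-term-null : ∀ x z → 1 ℕ.≤ z → Null λ n → recip ((n ⊕ x) ^⁺ z)
ζ-term-null x z 1≤z = n*r≤C⇒null 1ℝ λ n 1≤n → let open ≤-Reasoning ; W = (n ⊕ x) ^⁺ z in begin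
  fromℕ n * recip W  ≈⟨ *-comm (fromℕ n) (recip W) ⟩
  recip W * fromℕ n  ≲⟨ *-monoʳ-≤ (recip-nonNeg W) (fromℕ≤⊕^ x 1≤n 1≤z) ⟩
  recip W * val W    ≈⟨ recip-inverse W ⟩
  1ℝ                 ∎

-- The exponent z = 1 is included, where convergence is only conditional; hence Leibniz and not
-- absolute comparison.
ζ-converges : ∀ x z → 1 ℕ.≤ z → ∃ λ L → Limit (alternating λ n → recip ((n ⊕ x) ^⁺ z)) L
ζ-converges x z 1≤z = let L , lim , _ = leibniz
                            (λ n → nonNeg⇒0≤ (recip-nonNeg ((n ⊕ x) ^⁺ z)))
                            (λ n → recip-antimono-≤ ((n ⊕ x) ^⁺ z) ((suc n ⊕ x) ^⁺ z) (⊕^≤suc-⊕^ n x z))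
                            (ζ-term-null x z 1≤z)
                      in L , lim

-- Absolute convergence by telescoping comparison.

2ℝ : ℝ
2ℝ = 1ℝ + 1ℝ

2ℝ-nonNeg : NonNegative 2ℝ
2ℝ-nonNeg = always λ _ → ℚ.<⇒≤ (ℚ.positive⁻¹ (1ℚ ℚ.+ 1ℚ))

recip-cong : ∀ {x y} → val x ≈ val y → recip x ≈ recip y
recip-cong {x} {y} h = ≤-antisym (recip-antimono-≤ y x (≈⇒≤ (≈-sym h))) (recip-antimono-≤ x y (≈⇒≤ h))

∑-telescope-≤ : ∀ m {c r : ℕ → ℝ} → (∀ i → 0ℝ ≤ r i) → (∀ i → c i ≤ r i - r (suc i)) → (∑< m) c ≤ r 0
∑-telescope-≤ zero    r≥0 h = r≥0 0
∑-telescope-≤ (suc m) {c} {r} r≥0 h = ≤-trans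
  (+-mono-≤ (h 0) (∑-telescope-≤ m {λ i → c (suc i)} {λ i → r (suc i)} (λ i → r≥0 (suc i)) (λ i → h (suc i))))
  (≈⇒≤ (≡⇒≈ λ k → solve 2 (λ x y → x :- y :+ y := x) refl (seq (r 0) k) (seq (r 1) k)))

-- The absolute values of a block starting at n sum to at most a telescoping sum, so to at most
-- `r n`, independently of the length of the block.
telescoping-converges : ∀ {t r} k → (∀ n → 0ℝ ≤ r n) → Null r →
  (∀ n → k ℕ.≤ n → ∣ t n ∣ ≤ r n - r (suc n)) → ∃ λ L → Limit (λ m → (∑< m) t) L
telescoping-converges {t} {r} k r≥0 r↓ h =
  let L , lim , _ = complete {s = λ m → (∑< m) t} k r↓ tail in L , lim
  where
  tail : ∀ n m → k ℕ.≤ n → ∣ (∑< (n ℕ.+ m)) t - (∑< n) t ∣ ≤ r n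
  tail n m k≤n = begin
    ∣ (∑< (n ℕ.+ m)) t - (∑< n) t ∣      ≈⟨ ∣∣-cong (∑-tail n m t) ⟩
    ∣ (∑< m) (λ i → t (n ℕ.+ i)) ∣       ≲⟨ ∣∑∣≤∑∣∣ m (λ i → t (n ℕ.+ i)) ⟩
    (∑< m) (λ i → ∣ t (n ℕ.+ i) ∣)       ≲⟨ ∑-telescope-≤ m {r = λ i → r (n ℕ.+ i)}
                                              (λ i → r≥0 (n ℕ.+ i)) step ⟩
    r (n ℕ.+ 0)                          ≡⟨ cong r (ℕ.+-identityʳ n) ⟩
    r n                                  ∎
    where
    open ≤-Reasoning
    step : ∀ i → ∣ t (n ℕ.+ i) ∣ ≤ r (n ℕ.+ i) - r (n ℕ.+ suc i)
    step i = subst (λ j → ∣ t (n ℕ.+ i) ∣ ≤ r (n ℕ.+ i) - r j) (sym (ℕ.+-suc n i))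
      (h (n ℕ.+ i) (ℕ.≤-trans k≤n (ℕ.m≤m+n n i)))

-- With v = n + x ≥ 1: v⁻ᶻ ≤ v⁻² ≤ 2/(v(v+1)) = 2/v - 2/(v+1). The factor 2 comes from 1/v ≤
-- 2/(v+1), that is, from v ≥ 1.
recip-power-telescopes : ∀ x {n z} → 1 ℕ.≤ n → 2 ℕ.≤ z →
  recip ((n ⊕ x) ^⁺ z) ≤ 2ℝ * recip ((n ⊕ x) ^⁺ 1) - 2ℝ * recip ((suc n ⊕ x) ^⁺ 1)
recip-power-telescopes x {n} {z} 1≤n 2≤z = begin
  recip ((n ⊕ x) ^⁺ z)   ≲⟨ recip-antimono-≤ ((n ⊕ x) ^⁺ 2) ((n ⊕ x) ^⁺ z)
                              (^-monoʳ-≤ (val-nonNeg (n ⊕ x)) (1≤⊕ x 1≤n) 2≤z) ⟩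
  recip ((n ⊕ x) ^⁺ 2)   ≈⟨ recip-^-* (n ⊕ x) 1 2 ⟩
  ρ ^ 2                  ≈⟨ *-cong ≈-refl (*-identityʳ ρ) ⟩
  ρ * ρ                  ≲⟨ *-monoʳ-≤ (recip-nonNeg V) ρ≤2σ ⟩
  ρ * (2ℝ * σ)           ≈⟨ (≡⇒≈ λ k → solve 3 (λ r t s → r :* (t :* s) := t :* (r :* s)) refl
                              (seq ρ k) (seq 2ℝ k) (seq σ k)) ⟩
  2ℝ * (ρ * σ)           ≈⟨ *-cong (≈-refl {2ℝ}) (≈-sym ρ-σ) ⟩
  2ℝ * (ρ - σ)           ≈⟨ (≡⇒≈ λ k → solve 3 (λ r t s → t :* (r :- s) := t :* r :- t :* s) refl
                              (seq ρ k) (seq 2ℝ k) (seq σ k)) ⟩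
  2ℝ * ρ - 2ℝ * σ        ∎
  where
  open ≤-Reasoning
  V = (n ⊕ x) ^⁺ 1
  V′ = (suc n ⊕ x) ^⁺ 1
  ρ = recip V
  σ = recip V′
  ρV = recip-inverse V
  σ[1+V] : σ * (1ℝ + val V) ≈ 1ℝ
  σ[1+V] = ≈-trans (*-cong (≈-refl {σ}) (≈-trans (+-cong (≈-refl {1ℝ}) (*-identityʳ (val (n ⊕ x))))
    (≈-trans (≈-sym (suc-⊕ n x)) (≈-sym (*-identityʳ (val (suc n ⊕ x))))))) (recip-inverse V′)
  -- Multiplying ρ by σ(1 + V) = 1; both the partial fraction `ρ-σ` and the estimate `ρ≤2σ` follow
  -- from this.
  ρ≈ρσ+σ : ρ ≈ ρ * σ + σ
  ρ≈ρσ+σ = ≈-trans (≈-sym (*-identityʳ ρ)) (≈-trans (*-cong (≈-refl {ρ}) (≈-sym σ[1+V]))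
    (≈-trans (≡⇒≈ λ k → solve 3 (λ r s v → r :* (s :* (con 1ℚ :+ v)) := r :* s :+ s :* (r :* v)) refl
        (seq ρ k) (seq σ k) (seq (val V) k))
      (+-cong ≈-refl (≈-trans (*-cong (≈-refl {σ}) ρV) (*-identityʳ σ)))))
  ρ-σ : ρ - σ ≈ ρ * σ
  ρ-σ = ≈-trans (+-cong ρ≈ρσ+σ ≈-refl)
    (≡⇒≈ λ k → solve 2 (λ p s → p :+ s :- s := p) refl (seq (ρ * σ) k) (seq σ k))
  ρ≤1 : ρ ≤ 1ℝ
  ρ≤1 = ≤-trans (≈⇒≤ (≈-sym (*-identityʳ ρ)))
    (≤-trans (*-monoʳ-≤ (recip-nonNeg V)
        (≤-trans (1≤⊕ x 1≤n) (≈⇒≤ (≈-sym (*-identityʳ (val (n ⊕ x)))))))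
      (≈⇒≤ ρV))
  ρ≤2σ : ρ ≤ 2ℝ * σ
  ρ≤2σ = begin
    ρ              ≈⟨ ρ≈ρσ+σ ⟩
    ρ * σ + σ      ≈⟨ +-cong (*-comm ρ σ) ≈-refl ⟩
    σ * ρ + σ      ≲⟨ +-mono-≤ (*-monoʳ-≤ (recip-nonNeg V′) ρ≤1) ≤-refl ⟩
    σ * 1ℝ + σ     ≈⟨ (≡⇒≈ λ k → solve 1 (λ s → s :* con 1ℚ :+ s := (con 1ℚ :+ con 1ℚ) :* s) refl
                        (seq σ k)) ⟩
    2ℝ * σ         ∎

0⊕^≤⊕^ : ∀ n x j → val ((0 ⊕ x) ^⁺ j) ≤ val ((n ⊕ x) ^⁺ j)
0⊕^≤⊕^ zero    x j = ≤-refl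
0⊕^≤⊕^ (suc n) x j = ≤-trans (0⊕^≤⊕^ n x j) (⊕^≤suc-⊕^ n x j)

-- One iterated series, with outer variable `x` and inner variable `y`.

module IteratedSeries (k q : ℕ) (1≤k : 1 ℕ.≤ k) (x y : ℝ⁺) where

  N : ℕ
  N = 2 ℕ.* q ℕ.+ 1

  X Y W : ℕ → ℝ⁺
  X n = (n ⊕ x) ^⁺ (2 ℕ.* k)
  Y i = (i ⊕ y) ^⁺ (2 ℕ.* k)
  W n = (n ⊕ x) ^⁺ (4 ℕ.* k ℕ.* (q ℕ.+ 1))

  innerTerm : ℕ → ℕ → ℝ
  innerTerm n i = sgn i * val (X n) / (X n +⁺ Y i)

  private
    2≤2k : 2 ℕ.≤ 2 ℕ.* k
    2≤2k = ℕ.*-monoʳ-≤ 2 1≤k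

    1≤2k : 1 ℕ.≤ 2 ℕ.* k
    1≤2k = ℕ.≤-trans (s≤s z≤n) 2≤2k

    f : ℕ → ℕ → ℝ
    f n i = val (X n) * recip (X n +⁺ Y i)

    f-nonNeg : ∀ n i → NonNegative (f n i)
    f-nonNeg n i = *-nonNeg {val (X n)} {recip (X n +⁺ Y i)} (val-nonNeg (X n)) (recip-nonNeg (X n +⁺ Y i))

    f-decreasing : ∀ n i → f n (suc i) ≤ f n i
    f-decreasing n i = *-monoʳ-≤ (val-nonNeg (X n))
      (recip-antimono-≤ (X n +⁺ Y i) (X n +⁺ Y (suc i))
        (+-mono-≤ ≤-refl (⊕^≤suc-⊕^ i y (2 ℕ.* k))))

    Y≤X+Y : ∀ n i → val (Y i) ≤ val (X n +⁺ Y i)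
    Y≤X+Y n i = ≤-trans (≈⇒≤ (≡⇒≈ λ m → sym (ℚ.+-identityˡ (seq (val (Y i)) m))))
      (+-mono-≤ (nonNeg⇒0≤ (val-nonNeg (X n))) ≤-refl)

    X≤X+Y : ∀ n i → val (X n) ≤ val (X n +⁺ Y i)
    X≤X+Y n i = ≤-trans (≈⇒≤ (≈-sym (+-identityʳ (val (X n)))))
      (+-mono-≤ ≤-refl (nonNeg⇒0≤ (val-nonNeg (Y i))))

    f≤1 : ∀ n i → f n i ≤ 1ℝ
    f≤1 n i = begin
      val (X n) * recip S   ≈⟨ *-comm (val (X n)) (recip S) ⟩
      recip S * val (X n)   ≲⟨ *-monoʳ-≤ (recip-nonNeg S) (X≤X+Y n i) ⟩
      recip S * val S       ≈⟨ recip-inverse S ⟩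
      1ℝ                    ∎
      where
      open ≤-Reasoning
      S = X n +⁺ Y i

    f-null : ∀ n → Null (f n)
    f-null n = n*r≤C⇒null (val (X n)) λ i 1≤i → let open ≤-Reasoning ; S = X n +⁺ Y i in begin
      fromℕ i * (val (X n) * recip S)  ≈⟨ (≡⇒≈ λ m → solve 3 (λ i x s → i :* (x :* s) := x :* (s :* i)) refl
                                             (seq (fromℕ i) m) (seq (val (X n)) m) (seq (recip S) m)) ⟩
      val (X n) * (recip S * fromℕ i)  ≲⟨ *-monoʳ-≤ (val-nonNeg (X n)) (*-monoʳ-≤ (recip-nonNeg S)
                                            (≤-trans (fromℕ≤⊕^ y 1≤i 1≤2k) (Y≤X+Y n i))) ⟩
      val (X n) * (recip S * val S)    ≈⟨ *-cong (≈-refl {val (X n)}) (recip-inverse S) ⟩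
      val (X n) * 1ℝ                   ≈⟨ *-identityʳ (val (X n)) ⟩
      val (X n)                        ∎

    innerSeries : ∀ n → ∃ λ L → Limit (alternating (f n)) L ×
      ∀ i → 0 ℕ.≤ i → ∣ L - alternating (f n) i ∣ ≤ f n i
    innerSeries n = leibniz (λ i → nonNeg⇒0≤ (f-nonNeg n i)) (f-decreasing n) (f-null n)

  inner : ℕ → ℝ
  inner n = proj₁ (innerSeries n)

  private
    ∑-innerTerm : ∀ n m → (∑< m) (innerTerm n) ≈ alternating (f n) m
    ∑-innerTerm n m = ∑-cong m λ i → *-assoc (sgn i) (val (X n)) (recip (X n +⁺ Y i))

  inner-converges : ∀ n → Limit (λ m → (∑< m) (innerTerm n)) (inner n)
  inner-converges n = limit-cong (λ m → ≈-sym (∑-innerTerm n m)) (proj₁ (proj₂ (innerSeries n)))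

  private
    inner-tail : ∀ n m → ∣ inner n - (∑< m) (innerTerm n) ∣ ≤ f n m
    inner-tail n m = ≤-trans
      (≈⇒≤ (∣∣-cong (+-cong (≈-refl {inner n}) (neg-cong (∑-innerTerm n m)))))
      (proj₂ (proj₂ (innerSeries n)) m z≤n)

    -- The Leibniz remainder at 0, where the partial sum is empty, bounds the whole inner series by
    -- its first term.
    ∣inner∣≤1 : ∀ n → ∣ inner n ∣ ≤ 1ℝ
    ∣inner∣≤1 n = ≤-trans (≈⇒≤ (∣∣-cong (≡⇒≈ λ m → sym (ℚ.+-identityʳ (seq (inner n) m)))))
      (≤-trans (inner-tail n 0) (f≤1 n 0))

    ∣outerTerm∣ : ∀ n z → ∣ sgn n / W n * z ∣ ≈ recip (W n) * ∣ z ∣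
    ∣outerTerm∣ n z = begin
      ∣ sgn n * recip (W n) * z ∣     ≈⟨ ∣∣-cong (*-assoc (sgn n) (recip (W n)) z) ⟩
      ∣ sgn n * (recip (W n) * z) ∣   ≈⟨ ∣sgn*x∣≈∣x∣ n (recip (W n) * z) ⟩
      ∣ recip (W n) * z ∣             ≈⟨ ∣x*y∣≈∣x∣*∣y∣ (recip (W n)) z ⟩
      ∣ recip (W n) ∣ * ∣ z ∣         ≈⟨ *-cong (nonNeg⇒∣x∣≈x (recip-nonNeg (W n))) ≈-refl ⟩
      recip (W n) * ∣ z ∣             ∎
      where open ≈-Reasoning

    2≤4k[q+1] : 2 ℕ.≤ 4 ℕ.* k ℕ.* (q ℕ.+ 1)
    2≤4k[q+1] = ℕ.*-mono-≤ {2} {4 ℕ.* k} {1}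
      (ℕ.≤-trans (s≤s (s≤s z≤n)) (ℕ.*-monoʳ-≤ 4 1≤k)) (ℕ.m≤n+m 1 q)

    outerSeries : ∃ λ L → Limit (λ m → (∑< m) λ n → sgn n / W n * inner n) L
    -- The comparison starts at n = 1 because it needs n + x ≥ 1. The exponent 1 inside `r` lets
    -- `ζ-term-null` provide its decay.
    outerSeries = telescoping-converges {r = r} 1
      (λ n → nonNeg⇒0≤ (*-nonNeg {2ℝ} {recip ((n ⊕ x) ^⁺ 1)} 2ℝ-nonNeg (recip-nonNeg ((n ⊕ x) ^⁺ 1))))
      (null-* 2ℝ 2ℝ-nonNeg (ζ-term-null x 1 ℕ.≤-refl))
      λ n 1≤n → let open ≤-Reasoning in begin
        ∣ sgn n / W n * inner n ∣   ≈⟨ ∣outerTerm∣ n (inner n) ⟩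
        recip (W n) * ∣ inner n ∣   ≲⟨ *-monoʳ-≤ (recip-nonNeg (W n)) (∣inner∣≤1 n) ⟩
        recip (W n) * 1ℝ            ≈⟨ *-identityʳ (recip (W n)) ⟩
        recip (W n)                 ≲⟨ recip-power-telescopes x 1≤n 2≤4k[q+1] ⟩
        r n - r (suc n)             ∎
      where
      r : ℕ → ℝ
      r n = 2ℝ * recip ((n ⊕ x) ^⁺ 1)

  outer : ℝ
  outer = proj₁ outerSeries

  outer-converges : Limit (λ m → (∑< m) λ n → sgn n / W n * inner n) outer
  outer-converges = proj₂ outerSeries

  -- As 4k(q+1) = 2k(N+1), the weight `W n` is the power N+1 of `X n`, and the numerator of the
  -- inner terms cancels one factor.
  recipW*X : ∀ n → recip (W n) * val (X n) ≈ recip (X n) ^ N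
  recipW*X n = begin
    recip (W n) * val (X n)
      ≡⟨ cong (λ e → recip ((n ⊕ x) ^⁺ e) * val (X n)) exponent ⟩
    recip ((n ⊕ x) ^⁺ (2 ℕ.* k ℕ.* suc N)) * val (X n)
      ≈⟨ *-cong (recip-^-* (n ⊕ x) (2 ℕ.* k) (suc N)) ≈-refl ⟩
    recip (X n) * recip (X n) ^ N * val (X n)
      ≈⟨ (≡⇒≈ λ m → solve 3 (λ r p v → r :* p :* v := r :* v :* p) refl
           (seq (recip (X n)) m) (seq (recip (X n) ^ N) m) (seq (val (X n)) m)) ⟩
    recip (X n) * val (X n) * recip (X n) ^ N
      ≈⟨ *-cong (recip-inverse (X n)) ≈-refl ⟩
    1ℝ * recip (X n) ^ N
      ≈⟨ *-identityˡ (recip (X n) ^ N) ⟩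
    recip (X n) ^ N ∎
    where
    open ≈-Reasoning
    exponent : 4 ℕ.* k ℕ.* (q ℕ.+ 1) ≡ 2 ℕ.* k ℕ.* suc N
    exponent = S.solve 2 (λ k q → S.con 4 S.:* k S.:* (q S.:+ S.con 1)
      S.:= S.con 2 S.:* k S.:* (S.con 1 S.:+ (S.con 2 S.:* q S.:+ S.con 1))) refl k q
      where module S = ℕ-Solver.+-*-Solver

  squareSum : ℕ → ℝ
  squareSum m = (∑< m) λ n → sgn n / W n * (∑< m) (innerTerm n)

  private
    C : ℝ
    C = recip (X 0) ^ N

    -- Both factors are freed from n: the weight by X n ≥ X 0, the remainder by X n + Y m ≥ Y m.
    term-bound : ∀ m n → ∣ sgn n / W n * (inner n - (∑< m) (innerTerm n)) ∣ ≤ C * recip (Y m)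
    term-bound m n = begin
      ∣ sgn n / W n * (inner n - (∑< m) (innerTerm n)) ∣
        ≈⟨ ∣outerTerm∣ n (inner n - (∑< m) (innerTerm n)) ⟩
      recip (W n) * ∣ inner n - (∑< m) (innerTerm n) ∣
        ≲⟨ *-monoʳ-≤ (recip-nonNeg (W n)) (inner-tail n m) ⟩
      recip (W n) * (val (X n) * recip (X n +⁺ Y m))
        ≈⟨ *-assoc (recip (W n)) (val (X n)) (recip (X n +⁺ Y m)) ⟨
      recip (W n) * val (X n) * recip (X n +⁺ Y m)
        ≈⟨ *-cong (recipW*X n) ≈-refl ⟩
      recip (X n) ^ N * recip (X n +⁺ Y m)
        ≲⟨ *-mono₂-≤ (^-nonNeg N (recip-nonNeg (X n))) (recip-nonNeg (Y m))
             (^-monoˡ-≤ N (recip-nonNeg (X n)) (recip-nonNeg (X 0))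
               (recip-antimono-≤ (X 0) (X n) (0⊕^≤⊕^ n x (2 ℕ.* k))))
             (recip-antimono-≤ (Y m) (X n +⁺ Y m) (Y≤X+Y n m)) ⟩
      C * recip (Y m) ∎
      where open ≤-Reasoning

    difference : ∀ m → (∑< m) (λ n → sgn n / W n * inner n) - squareSum m
      ≈ (∑< m) (λ n → sgn n / W n * (inner n - (∑< m) (innerTerm n)))
    difference m = go m (λ n → sgn n / W n) inner (λ n → (∑< m) (innerTerm n))
      where
      -- The length `j` is separated from the inner cutoff `m`, which has to stay fixed during the
      -- induction.
      go : ∀ j (w u v : ℕ → ℝ) →
        (∑< j) (λ n → w n * u n) - (∑< j) (λ n → w n * v n) ≈ (∑< j) (λ n → w n * (u n - v n))
      go zero    w u v = ≡⇒≈ λ _ → refl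
      go (suc j) w u v = ≈-trans
        (≡⇒≈ λ k → solve 5 (λ w u v s t → (w :* u :+ s) :- (w :* v :+ t) := w :* (u :- v) :+ (s :- t)) refl
          (seq (w 0) k) (seq (u 0) k) (seq (v 0) k)
          (seq ((∑< j) λ n → w (suc n) * u (suc n)) k) (seq ((∑< j) λ n → w (suc n) * v (suc n)) k))
        (+-cong ≈-refl (go j (λ n → w (suc n)) (λ n → u (suc n)) (λ n → v (suc n))))

  -- The tail of the inner series is at most its first omitted term, so replacing
  -- each inner sum by a partial sum of length m costs at most m C / Y m = O(1 / m).
  squareSum-approximates : Null λ m → ∣ (∑< m) (λ n → sgn n / W n * inner n) - squareSum m ∣
  squareSum-approximates = null-≤ (always λ m → let open ≤-Reasoning in begin
      ∣ (∑< m) (λ n → sgn n / W n * inner n) - squareSum m ∣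
        ≈⟨ ∣∣-cong (difference m) ⟩
      ∣ (∑< m) (λ n → sgn n / W n * (inner n - (∑< m) (innerTerm n))) ∣
        ≲⟨ ∣∑∣≤∑∣∣ m (λ n → sgn n / W n * (inner n - (∑< m) (innerTerm n))) ⟩
      (∑< m) (λ n → ∣ sgn n / W n * (inner n - (∑< m) (innerTerm n)) ∣)
        ≲⟨ ∑-mono-≤ m (term-bound m) ⟩
      (∑< m) (λ _ → C * recip (Y m))
        ≈⟨ ∑-const m (C * recip (Y m)) ⟩
      fromℕ m * (C * recip (Y m)) ∎)
    (n*r≤C⇒null C λ m 1≤m → let open ≤-Reasoning in begin
      fromℕ m * (fromℕ m * (C * recip (Y m)))
        ≈⟨ (≡⇒≈ λ j → solve 3 (λ m c r → m :* (m :* (c :* r)) := c :* (r :* (m :* (m :* con 1ℚ)))) refl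
             (seq (fromℕ m) j) (seq C j) (seq (recip (Y m)) j)) ⟩
      C * (recip (Y m) * fromℕ m ^ 2)
        ≲⟨ *-monoʳ-≤ (^-nonNeg N (recip-nonNeg (X 0)))
             (*-monoʳ-≤ (recip-nonNeg (Y m)) (fromℕ^≤⊕^ y 1≤m 2≤2k)) ⟩
      C * (recip (Y m) * val (Y m))
        ≈⟨ *-cong (≈-refl {C}) (recip-inverse (Y m)) ⟩
      C * 1ℝ
        ≈⟨ *-identityʳ C ⟩
      C ∎)

  squareSum-expand : ∀ m → squareSum m ≈ (∑< m) λ n → (∑< m) λ i →
    sgn n * sgn i * (recip (X n) ^ N * recip (X n +⁺ Y i))
  squareSum-expand m = ∑-cong m λ n → ≈-trans
    (*-distribˡ-sum {m} (sgn n / W n) λ i → innerTerm n (toℕ i))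
    (∑-cong m (term n))
    where
    term : ∀ n i → sgn n / W n * innerTerm n i
      ≈ sgn n * sgn i * (recip (X n) ^ N * recip (X n +⁺ Y i))
    term n i = begin
      sgn n * recip (W n) * (sgn i * val (X n) * R)
        ≈⟨ (≡⇒≈ λ j → solve 5 (λ s w t v r → s :* w :* (t :* v :* r) := s :* t :* ((w :* v) :* r)) refl
             (seq (sgn n) j) (seq (recip (W n)) j) (seq (sgn i) j) (seq (val (X n)) j) (seq R j)) ⟩
      sgn n * sgn i * (recip (W n) * val (X n) * R)
        ≈⟨ *-cong (≈-refl {sgn n * sgn i}) (*-cong (recipW*X n) (≈-refl {R})) ⟩
      sgn n * sgn i * (recip (X n) ^ N * R) ∎
      where
      open ≈-Reasoning
      R = recip (X n +⁺ Y i)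

-- The finite identity for odd N.

-- A geometric sum of ratio -v/u, with value uv(uᴺ - (-v)ᴺ)/(u + v); the hypothesis on `r` stands in
-- for the division by u + v. In the induction the term p = 1 splits off, and the rest is -v times
-- the sum for N.
alternating-geometric : ∀ N {u v r} → r * (u + v) ≈ u * v →
  (∑₁≤ N) (λ p → sgn (p ℕ.+ 1) * v ^ p * u ^ (N ℕ.∸ p ℕ.+ 1)) ≈ r * (u ^ N - sgn N * v ^ N)
alternating-geometric zero {u} {v} {r} h = ≡⇒≈ λ j →
  solve 1 (λ r → con 0ℚ := r :* (con 1ℚ :- con 1ℚ :* con 1ℚ)) refl (seq r j)
alternating-geometric (suc N) {u} {v} {r} h = begin
  sgn 2 * v ^ 1 * u ^ (N ℕ.+ 1) + sum {N} (λ i → g (suc N) (suc (suc (toℕ i))))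
    ≈⟨ +-cong (*-cong (≈-refl {sgn 2 * v ^ 1}) (^-congʳ u (ℕ.+-comm N 1)))
         (sum-cong-≋ {N} λ i → pull (suc (toℕ i))) ⟩
  sgn 2 * v ^ 1 * (u * u ^ N) + sum {N} (λ i → - v * g N (suc (toℕ i)))
    ≈⟨ +-cong ≈-refl (*-distribˡ-sum {N} (- v) λ i → g N (suc (toℕ i))) ⟨
  sgn 2 * v ^ 1 * (u * u ^ N) + - v * (∑₁≤ N) (g N)
    ≈⟨ +-cong
         (≡⇒≈ λ j → solve 3 (λ v u p →
             (:- con 1ℚ :* (:- con 1ℚ :* con 1ℚ)) :* (v :* con 1ℚ) :* (u :* p) := p :* (u :* v)) refl
           (seq v j) (seq u j) (seq (u ^ N) j))
         (*-cong (≈-refl { - v}) (alternating-geometric N h)) ⟩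
  u ^ N * (u * v) + - v * (r * (u ^ N - sgn N * v ^ N))
    ≈⟨ +-cong (*-cong (≈-refl {u ^ N}) (≈-sym h)) ≈-refl ⟩
  u ^ N * (r * (u + v)) + - v * (r * (u ^ N - sgn N * v ^ N))
    ≈⟨ (≡⇒≈ λ j → solve 6 (λ p r u v s t →
           p :* (r :* (u :+ v)) :+ (:- v) :* (r :* (p :- s :* t))
             := r :* (u :* p :- (:- con 1ℚ :* s) :* (v :* t))) refl
         (seq (u ^ N) j) (seq r j) (seq u j) (seq v j) (seq (sgn N) j) (seq (v ^ N) j)) ⟩
  r * (u ^ suc N - sgn (suc N) * v ^ suc N) ∎
  where
  open ≈-Reasoning
  g : ℕ → ℕ → ℝ
  g N p = sgn (p ℕ.+ 1) * v ^ p * u ^ (N ℕ.∸ p ℕ.+ 1)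
  pull : ∀ p → g (suc N) (suc p) ≈ - v * g N p
  pull p = ≡⇒≈ λ j → solve 4 (λ s v t w → (:- con 1ℚ :* s) :* (v :* t) :* w := (:- v) :* (s :* t :* w)) refl
    (seq (sgn (p ℕ.+ 1)) j) (seq v j) (seq (v ^ p) j) (seq (u ^ (N ℕ.∸ p ℕ.+ 1)) j)

sgn-odd : ∀ q → sgn (2 ℕ.* q ℕ.+ 1) ≈ - 1ℝ
sgn-odd q = begin
  sgn (2 ℕ.* q ℕ.+ 1)    ≈⟨ ^-homo-* (- 1ℝ) (2 ℕ.* q) 1 ⟩
  sgn (2 ℕ.* q) * sgn 1  ≈⟨ *-cong (≈-sym (^-assocʳ (- 1ℝ) 2 q)) (≈-refl {sgn 1}) ⟩
  sgn 2 ^ q * sgn 1      ≈⟨ *-cong (≈-trans (^-congˡ q (≡⇒≈ λ _ → refl)) (1^n≈1 q)) (≈-refl {sgn 1}) ⟩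
  1ℝ * sgn 1             ≈⟨ (≡⇒≈ λ _ → refl) ⟩
  - 1ℝ                   ∎
  where open ≈-Reasoning

recip-+ : ∀ x y → recip (x +⁺ y) * (recip x + recip y) ≈ recip x * recip y
recip-+ x y = begin
  r * (u + v)
    ≈⟨ *-cong (≈-refl {r}) (+-cong
         (≈-sym (≈-trans (*-cong (≈-refl {u}) (recip-inverse y)) (*-identityʳ u)))
         (≈-sym (≈-trans (*-cong (≈-refl {v}) (recip-inverse x)) (*-identityʳ v)))) ⟩
  r * (u * (v * val y) + v * (u * val x))
    ≈⟨ (≡⇒≈ λ j → solve 5 (λ r u v x y →
           r :* (u :* (v :* y) :+ v :* (u :* x)) := u :* v :* (r :* (x :+ y))) refl
         (seq r j) (seq u j) (seq v j) (seq (val x) j) (seq (val y) j)) ⟩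
  u * v * (r * val (x +⁺ y))
    ≈⟨ *-cong (≈-refl {u * v}) (recip-inverse (x +⁺ y)) ⟩
  u * v * 1ℝ
    ≈⟨ *-identityʳ (u * v) ⟩
  u * v ∎
  where
  open ≈-Reasoning
  r = recip (x +⁺ y)
  u = recip x
  v = recip y

-- Here oddness enters: (-1)ᴺ = -1 turns the difference in `alternating-geometric` into a sum with
-- one summand for each iterated series.
odd-power-sum : ∀ q x y → let N = 2 ℕ.* q ℕ.+ 1 in
  recip x ^ N * recip (x +⁺ y) + recip y ^ N * recip (y +⁺ x)
    ≈ (∑₁≤ N) (λ p → sgn (p ℕ.+ 1) * recip y ^ p * recip x ^ (N ℕ.∸ p ℕ.+ 1))
odd-power-sum q x y = begin
  recip x ^ N * r + recip y ^ N * recip (y +⁺ x)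
    ≈⟨ +-cong (≈-refl {recip x ^ N * r}) (*-cong (≈-refl {recip y ^ N})
         (recip-cong {y +⁺ x} {x +⁺ y} (≡⇒≈ λ j → ℚ.+-comm (seq (val y) j) (seq (val x) j)))) ⟩
  recip x ^ N * r + recip y ^ N * r
    ≈⟨ (≡⇒≈ λ j → solve 3 (λ p t r → p :* r :+ t :* r := r :* (p :- (:- con 1ℚ) :* t)) refl
         (seq (recip x ^ N) j) (seq (recip y ^ N) j) (seq r j)) ⟩
  r * (recip x ^ N - - 1ℝ * recip y ^ N)
    ≈⟨ *-cong (≈-refl {r}) (+-cong (≈-refl {recip x ^ N})
         (neg-cong (*-cong (≈-sym (sgn-odd q)) (≈-refl {recip y ^ N})))) ⟩
  r * (recip x ^ N - sgn N * recip y ^ N)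
    ≈⟨ alternating-geometric N (recip-+ x y) ⟨
  (∑₁≤ N) (λ p → sgn (p ℕ.+ 1) * recip y ^ p * recip x ^ (N ℕ.∸ p ℕ.+ 1)) ∎
  where
  open ≈-Reasoning
  N = 2 ℕ.* q ℕ.+ 1
  r = recip (x +⁺ y)

-- Products of zeta sums and the passage to the limit.

∑-*-∑ : ∀ m c (α β : ℕ → ℝ) →
  c * (∑< m) α * (∑< m) β ≈ (∑< m) λ n → (∑< m) λ i → c * α i * β n
∑-*-∑ m c α β = ≈-trans
  (*-distribˡ-sum {m} (c * (∑< m) α) λ n → β (toℕ n))
  (∑-cong m λ n → ≈-trans
    (*-cong (*-distribˡ-sum {m} c λ i → α (toℕ i)) (≈-refl {β n}))
    (*-distribʳ-sum {m} (β n) λ i → c * α (toℕ i)))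

ζ-partial : ℝ⁺ → ℕ → ℕ → ℝ
ζ-partial x z = alternating λ n → recip ((n ⊕ x) ^⁺ z)

-- The value at z = 0, where the series diverges, is junk.
ζ-value : ℝ⁺ → ℕ → ℝ
ζ-value x zero    = 0ℝ
ζ-value x (suc z) = proj₁ (ζ-converges x (suc z) (s≤s z≤n))

ζ-limit : ∀ x z → 1 ℕ.≤ z → Limit (ζ-partial x z) (ζ-value x z)
ζ-limit x (suc z) _ = proj₂ (ζ-converges x (suc z) (s≤s z≤n))

module Reciprocity (k q : ℕ) (1≤k : 1 ℕ.≤ k) (a b : ℝ⁺) where

  module L = IteratedSeries k q 1≤k b a
  module R = IteratedSeries k q 1≤k a b

  -- `X` and `Y` of `R` are `Y` and `X` of `L` by definition, so one pair of names serves both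
  -- series.
  open L using (N; X; Y)

  private
    U V : ℕ → ℝ
    U n = recip (X n)
    V i = recip (Y i)

    h : ℕ → ℕ → ℕ → ℝ
    h n i p = sgn n * sgn i * (sgn (p ℕ.+ 1) * V i ^ p * U n ^ (N ℕ.∸ p ℕ.+ 1))

    termˡ termʳ : ℕ → ℕ → ℝ
    termˡ n i = sgn n * sgn i * (U n ^ N * recip (X n +⁺ Y i))
    termʳ i n = sgn i * sgn n * (V i ^ N * recip (Y i +⁺ X n))

    -- The term at (n, i) of one square is paired with the term at the transposed position (i, n) of
    -- the other; both have the sign (-1)ⁿ⁺ⁱ.
    term-identity : ∀ n i → termˡ n i + termʳ i n ≈ (∑₁≤ N) (h n i)
    term-identity n i = begin
      termˡ n i + termʳ i n
        ≈⟨ (≡⇒≈ λ j → solve 4 (λ s t x y → s :* t :* x :+ t :* s :* y := s :* t :* (x :+ y)) refl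
             (seq (sgn n) j) (seq (sgn i) j) (seq (U n ^ N * recip (X n +⁺ Y i)) j)
             (seq (V i ^ N * recip (Y i +⁺ X n)) j)) ⟩
      sgn n * sgn i * (U n ^ N * recip (X n +⁺ Y i) + V i ^ N * recip (Y i +⁺ X n))
        ≈⟨ *-cong (≈-refl {sgn n * sgn i}) (odd-power-sum q (X n) (Y i)) ⟩
      sgn n * sgn i * (∑₁≤ N) (λ p → sgn (p ℕ.+ 1) * V i ^ p * U n ^ (N ℕ.∸ p ℕ.+ 1))
        ≈⟨ *-distribˡ-sum {N} (sgn n * sgn i) (λ p → sgn (suc (toℕ p) ℕ.+ 1)
             * V i ^ suc (toℕ p) * U n ^ (N ℕ.∸ suc (toℕ p) ℕ.+ 1)) ⟩
      (∑₁≤ N) (h n i) ∎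
      where open ≈-Reasoning

    product-expand : ∀ m p →
      sgn (p ℕ.+ 1) * ζ-partial a (2 ℕ.* k ℕ.* p) m * ζ-partial b (2 ℕ.* k ℕ.* (N ℕ.∸ p ℕ.+ 1)) m
        ≈ (∑< m) λ n → (∑< m) λ i → h n i p
    product-expand m p = begin
      sgn (p ℕ.+ 1) * ζ-partial a (2 ℕ.* k ℕ.* p) m * ζ-partial b (2 ℕ.* k ℕ.* e) m
        ≈⟨ *-cong
             (*-cong (≈-refl {sgn (p ℕ.+ 1)})
               (∑-cong m λ i → *-cong (≈-refl {sgn i}) (recip-^-* (i ⊕ a) (2 ℕ.* k) p)))
             (∑-cong m λ n → *-cong (≈-refl {sgn n}) (recip-^-* (n ⊕ b) (2 ℕ.* k) e)) ⟩
      sgn (p ℕ.+ 1) * (∑< m) (λ i → sgn i * V i ^ p) * (∑< m) (λ n → sgn n * U n ^ e)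
        ≈⟨ ∑-*-∑ m (sgn (p ℕ.+ 1)) (λ i → sgn i * V i ^ p) (λ n → sgn n * U n ^ e) ⟩
      (∑< m) (λ n → (∑< m) λ i → sgn (p ℕ.+ 1) * (sgn i * V i ^ p) * (sgn n * U n ^ e))
        ≈⟨ (∑-cong m λ n → ∑-cong m (rearrange n)) ⟩
      (∑< m) (λ n → (∑< m) λ i → h n i p) ∎
      where
      open ≈-Reasoning
      e = N ℕ.∸ p ℕ.+ 1
      rearrange : ∀ n i → sgn (p ℕ.+ 1) * (sgn i * V i ^ p) * (sgn n * U n ^ e) ≈ h n i p
      rearrange n i = ≡⇒≈ λ j →
        solve 5 (λ c s v t u → c :* (s :* v) :* (t :* u) := t :* s :* (c :* v :* u)) refl
          (seq (sgn (p ℕ.+ 1)) j) (seq (sgn i) j) (seq (V i ^ p) j)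
          (seq (sgn n) j) (seq (U n ^ e) j)

  zetaSum : ℕ → ℝ
  zetaSum m = (∑₁≤ N) λ p →
    sgn (p ℕ.+ 1) * ζ-partial a (2 ℕ.* k ℕ.* p) m * ζ-partial b (2 ℕ.* k ℕ.* (N ℕ.∸ p ℕ.+ 1)) m

  squareSum-identity : ∀ m → L.squareSum m + R.squareSum m ≈ zetaSum m
  squareSum-identity m = begin
    L.squareSum m + R.squareSum m
      ≈⟨ +-cong (L.squareSum-expand m) (R.squareSum-expand m) ⟩
    (∑< m) (λ n → (∑< m) λ i → termˡ n i) + (∑< m) (λ i → (∑< m) λ n → termʳ i n)
      -- The second square is transposed so that paired terms meet at the same (n, i); both cutoffs
      -- are `m`, so the index set is unchanged.
      ≈⟨ +-cong ≈-refl (∑-comm {m} {m} λ i n → termʳ (toℕ i) (toℕ n)) ⟩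
    (∑< m) (λ n → (∑< m) λ i → termˡ n i) + (∑< m) (λ n → (∑< m) λ i → termʳ i n)
      ≈⟨ ∑-distrib-+ {m} (λ n → (∑< m) λ i → termˡ (toℕ n) i) (λ n → (∑< m) λ i → termʳ i (toℕ n)) ⟨
    (∑< m) (λ n → (∑< m) (λ i → termˡ n i) + (∑< m) (λ i → termʳ i n))
      ≈⟨ (∑-cong m λ n → ≈-trans
            (≈-sym (∑-distrib-+ {m} (λ i → termˡ n (toℕ i)) (λ i → termʳ (toℕ i) n)))
            (∑-cong m λ i → term-identity n i)) ⟩
    (∑< m) (λ n → (∑< m) λ i → (∑₁≤ N) (h n i))
      ≈⟨ (∑-cong m λ n → ∑-comm {m} {N} λ i p → h n (toℕ i) (suc (toℕ p))) ⟩
    (∑< m) (λ n → (∑₁≤ N) λ p → (∑< m) λ i → h n i p)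
      ≈⟨ ∑-comm {m} {N} (λ n p → (∑< m) λ i → h (toℕ n) i (suc (toℕ p))) ⟩
    (∑₁≤ N) (λ p → (∑< m) λ n → (∑< m) λ i → h n i p)
      ≈⟨ sum-cong-≋ {N} (λ p → product-expand m (suc (toℕ p))) ⟨
    zetaSum m ∎
    where open ≈-Reasoning

  zetaSum-limit : Limit zetaSum ((∑₁≤ N) λ p →
    sgn (p ℕ.+ 1) * ζ-value a (2 ℕ.* k ℕ.* p) * ζ-value b (2 ℕ.* k ℕ.* (N ℕ.∸ p ℕ.+ 1)))
  zetaSum-limit = limit-sum {N} λ i → let p = suc (toℕ i) in
    limit-* (limit-* (limit-const (sgn (p ℕ.+ 1)))
        (ζ-limit a (2 ℕ.* k ℕ.* p) (ℕ.*-mono-≤ 1≤2k (s≤s z≤n))))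
      -- The `+ 1` keeps this exponent positive even at p = N, away from the junk value of `ζ-value`
      -- at 0.
      (ζ-limit b (2 ℕ.* k ℕ.* (N ℕ.∸ p ℕ.+ 1)) (ℕ.*-mono-≤ 1≤2k (ℕ.m≤n+m 1 (N ℕ.∸ p))))
    where
    1≤2k : 1 ℕ.≤ 2 ℕ.* k
    1≤2k = ℕ.≤-trans 1≤k (ℕ.m≤m+n k _)

  -- Both sides are limits of the single sequence `zetaSum`, by way of the square sums on the left
  -- and of the partial zeta sums on the right.
  reciprocity : L.outer + R.outer ≈ (∑₁≤ N) λ p →
    sgn (p ℕ.+ 1) * ζ-value a (2 ℕ.* k ℕ.* p) * ζ-value b (2 ℕ.* k ℕ.* (N ℕ.∸ p ℕ.+ 1))
  reciprocity = limit-unique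
    (limit-cong squareSum-identity
      (limit-+ (limit-perturb L.squareSum-approximates L.outer-converges)
               (limit-perturb R.squareSum-approximates R.outer-converges)))
    zetaSum-limit
    where
    limit-perturb : ∀ {s t K} → Null (λ n → ∣ s n - t n ∣) → Limit s K → Limit t K
    limit-perturb {s} {t} {K} d s→ = null-≤
      (always λ n → ≤-trans (∣x-z∣≤∣x-y∣+∣y-z∣ (t n) (s n) K)
        (+-mono-≤ (≈⇒≤ (∣x-y∣≈∣y-x∣ (t n) (s n))) ≤-refl))
      (null-+ d s→)

corollary1p24 : (k q : ℕ) → 1 ℕ.≤ k → 1 ℕ.≤ q → (a b : ℝ⁺) →
    let N = 2 ℕ.* q ℕ.+ 1 in
    ∃ λ (ζa : ℕ → ℝ) → ∃ λ (ζb : ℕ → ℝ) →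
    ∃ λ (innerˡ : ℕ → ℝ) → ∃ λ (innerʳ : ℕ → ℝ) →
    ∃ λ (outerˡ : ℝ) → ∃ λ (outerʳ : ℝ) →
    (∀ z → 1 ℕ.≤ z → ζE[ z , a ]≔ ζa z)
    × (∀ z → 1 ℕ.≤ z → ζE[ z , b ]≔ ζb z)
    × (∀ n → (λ i → sgn i * val ((n ⊕ b) ^⁺ (2 ℕ.* k))
    / ((n ⊕ b) ^⁺ (2 ℕ.* k) +⁺ (i ⊕ a) ^⁺ (2 ℕ.* k)))
    SumsTo innerˡ n)
    × (∀ n → (λ i → sgn i * val ((n ⊕ a) ^⁺ (2 ℕ.* k))
    / ((n ⊕ a) ^⁺ (2 ℕ.* k) +⁺ (i ⊕ b) ^⁺ (2 ℕ.* k)))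
    SumsTo innerʳ n)
    × ((λ n → sgn n / (n ⊕ b) ^⁺ (4 ℕ.* k ℕ.* (q ℕ.+ 1)) * innerˡ n) SumsTo outerˡ)
    × ((λ n → sgn n / (n ⊕ a) ^⁺ (4 ℕ.* k ℕ.* (q ℕ.+ 1)) * innerʳ n) SumsTo outerʳ)
    × (outerˡ + outerʳ
    ≈ (∑₁≤ N) (λ p → sgn (p ℕ.+ 1) * ζa (2 ℕ.* k ℕ.* p)
    * ζb (2 ℕ.* k ℕ.* (N ℕ.∸ p ℕ.+ 1))))
corollary1p24 k q 1≤k 1≤q a b =
  ζ-value a , ζ-value b , L.inner , R.inner , L.outer , R.outer
  , (λ z 1≤z → limit⇒⟶ (ζ-limit a z 1≤z))
  , (λ z 1≤z → limit⇒⟶ (ζ-limit b z 1≤z))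
  , (λ n → limit⇒⟶ (L.inner-converges n))
  , (λ n → limit⇒⟶ (R.inner-converges n))
  , limit⇒⟶ L.outer-converges
  , limit⇒⟶ R.outer-converges
  , reciprocity
  where open Reciprocity k q 1≤k a b
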